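{- Let $\mathrm{CLKID}^\omega_{ - }$ denote $\mathrm{CLKID}^\omega$ without the rule $(\mathrm{Cut})$. Fix a signature and an inductive definition set $\Phi$. If $\mathrm{Pr}$ is a $\mathrm{CLKID}^\omega_{ - }$ proof of $\Gamma\vdash\Delta$ in which every substitution used in an instance of $(\mathrm{Subst})$ is atomic, then there is a $\mathrm{CLKID}^\omega_{ - }$ proof of $\Gamma\vdash\Delta$ that contains no instance of $(\mathrm{Subst})$ and uses only inference rules occurring in $\mathrm{Pr}$.
   Context: A substitution (finite map from variables to terms) is atomic if its image contains only variables and constant symbols. Language. Terms are built from variables and function symbols of fixed arity. Predicate symbols: equality $=$, ordinary predicate symbols $Q$, inductive predicate symbols $P$. Formulas: $\phi::=P(\vec t)\mid Q(\vec u)\mid t=u\mid\lnot\phi\mid\phi\vee\phi\mid\phi\wedge\phi\mid\phi\to\phi\mid\exists x.\phi\mid\forall x.\phi$, up to $\alpha$-equivalence. An inductive definition set $\Phi$ is a finite set of productions $\dfrac{Q_1(\vec{u_1}(\vec x))\ \cdots\ Q_n(\vec{u_n}(\vec x))\ P_1(\vec{t_1}(\vec x))\ \cdots\ P_m(\vec{t_m}(\vec x))}{P(\vec t(\vec x))}$. Sequents $\Gamma\vdash\Delta$ have finite sets of formulas on each side. Rules of $\mathrm{CLKID}^\omega$: $(\mathrm{Axiom})$: $\Gamma\vdash\Delta$ if $\Gamma\cap\Delta\neq\emptyset$; $(=\mathrm{R})$: $\Gamma\vdash t=t,\Delta$; $(\mathrm{Wk})$; $(\mathrm{Cut})$; $(\mathrm{Subst})$: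 from $\Gamma\vdash\Delta$ infer $\Gamma[\theta]\vdash\Delta[\theta]$; standard LK rules for $\lnot,\vee,\wedge,\to$; $(\forall\mathrm{L})$, $(\exists\mathrm{R})$ with arbitrary witness term; $(\forall\mathrm{R})$, $(\exists\mathrm{L})$ with fresh eigenvariable; $(=\mathrm{L})$: from $\Gamma[u/x,t/y]\vdash\Delta[u/x,t/y]$ infer $\Gamma[t/x,u/y],t=u\vdash\Delta[t/x,u/y]$; $(\mathrm{UL})$: from $\Gamma,P(\vec u)\vdash\Delta$ one premise per production of $P$, namely $\Gamma,\vec u=\vec t(\vec y),Q_1(\vec{u_1}(\vec y)),\dots,P_m(\vec{t_m}(\vec y))\vdash\Delta$ with $\vec y$ fresh; $(\mathrm{UR})$: for a production, from $\Gamma\vdash Q_i(\vec{u_i}(\vec u)),\Delta$ and $\Gamma\vdash P_j(\vec{t_j}(\vec u)),\Delta$ for all $i,j$ infer $\Gamma\vdash P(\vec t(\vec u)),\Delta$. A pre-proof is a finite derivation tree whose leaves are axiom instances or buds, each bud assigned a companion (an internal node labelled by the identical sequent). Paths follow conclusion-to-premise edges and bud-to-companion edges. A trace along a path $(e_i)$ is a sequence of occurrences $C_i$ of inductive atoms in the antecedents of $e_i$ where: if $e_i$ is the conclusion of $(\mathrm{UL})$ unfolding $C_i$, then $C_{i+1}$ is an inductive atom introduced by that unfolding and $i$ is a progressing point; otherwise $C_{i+1}$ is the occurrence corresponding to $C_i$. A proof is a pre-proof in which every infinite path has a tail with a trace having infinitely many progressing points. -}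

module Defs where

-- Cyclic sequent calculus CLKIDω (Brotherston) for first-order logic with
-- inductive definitions.  Formulas are represented in locally nameless style
-- (free variables are names in ℕ, bound variables are de Bruijn indices),
-- so that syntactic equality of formulas is α-equivalence.  Sequents are
-- pairs of lists read as finite SETS (all comparisons of sequents are up to
-- set equality, i.e. mutual inclusion).

open import Data.Nat using (ℕ; zero; suc; _≤_; _+_)
open import Data.Nat.Properties using (_≟_)
open import Data.Fin using (Fin; zero; suc)
open import Data.Vec as Vec using (Vec; []; _∷_)
open import Data.Vec.Relation.Unary.Any as VAny using ()
open import Data.List using (List; []; _∷_; map; _++_; _∷ʳ_; length)
open import Data.List.Membership.Propositional using (_∈_)
open import Data.List.Relation.Unary.All using (All; []; _∷_)
open import Data.List.Relation.Unary.Any using (Any)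
open import Data.List.Relation.Binary.Subset.Propositional using (_⊆_)
open import Data.Product using (Σ; _×_; _,_; ∃; ∃-syntax)
open import Data.Sum using (_⊎_)
open import Data.Bool using (Bool; true; false)
open import Data.Unit using (⊤)
open import Relation.Binary.PropositionalEquality using (_≡_; _≢_)
open import Relation.Nullary using (¬_; yes; no)
open import Function using (_∘_)
open import Function.Definitions using (Injective)

record Sig : Set₁ where
  field
    Fun   : Set
    funAr : Fun → ℕ
    Ord   : Set          -- ordinary predicate symbols Q
    ordAr : Ord → ℕ
    Ind   : Set
    indAr : Ind → ℕ

Var : Set
Var = ℕ

Addr : Set
Addr = List ℕ

module Syn (S : Sig) where
  open Sig S

  data Term (n : ℕ) : Set where
    var  : Var → Term n
    bvar : Fin n → Term n
    app  : (f : Fun) → Vec (Term n) (funAr f) → Term n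

  infix 7 _≐_
  infixr 5 _∨'_ _∧'_
  infixr 4 _⇒'_

  data Formula (n : ℕ) : Set where
    indA : (P : Ind) → Vec (Term n) (indAr P) → Formula n
    ordA : (Q : Ord) → Vec (Term n) (ordAr Q) → Formula n
    _≐_  : Term n → Term n → Formula n
    ¬'_  : Formula n → Formula n
    _∨'_ _∧'_ _⇒'_ : Formula n → Formula n → Formula n
    ∃' ∀' : Formula (suc n) → Formula n

  Form : Set
  Form = Formula 0

  mutual
    renT : ∀ {n m} → (Fin n → Fin m) → Term n → Term m
    renT ρ (var x)    = var x
    renT ρ (bvar i)   = bvar (ρ i)
    renT ρ (app f ts) = app f (renTs ρ ts)

    renTs : ∀ {n m k} → (Fin n → Fin m) → Vec (Term n) k → Vec (Term m) k
    renTs ρ []       = []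
    renTs ρ (t ∷ ts) = renT ρ t ∷ renTs ρ ts

  mutual
    subT : ∀ {n m} → (Var → Term m) → (Fin n → Term m) → Term n → Term m
    subT f b (var x)    = f x
    subT f b (bvar i)   = b i
    subT f b (app g ts) = app g (subTs f b ts)

    subTs : ∀ {n m k} → (Var → Term m) → (Fin n → Term m) → Vec (Term n) k → Vec (Term m) k
    subTs f b []       = []
    subTs f b (t ∷ ts) = subT f b t ∷ subTs f b ts

  liftB : ∀ {n m} → (Fin n → Term m) → Fin (suc n) → Term (suc m)
  liftB b zero    = bvar zero
  liftB b (suc i) = renT suc (b i)

  subF : ∀ {n m} → (Var → Term m) → (Fin n → Term m) → Formula n → Formula m
  subF f b (indA P ts) = indA P (subTs f b ts)
  subF f b (ordA Q ts) = ordA Q (subTs f b ts)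
  subF f b (t ≐ u)     = subT f b t ≐ subT f b u
  subF f b (¬' A)      = ¬' subF f b A
  subF f b (A ∨' B)    = subF f b A ∨' subF f b B
  subF f b (A ∧' B)    = subF f b A ∧' subF f b B
  subF f b (A ⇒' B)    = subF f b A ⇒' subF f b B
  subF f b (∃' A)      = ∃' (subF (renT suc ∘ f) (liftB b) A)
  subF f b (∀' A)      = ∀' (subF (renT suc ∘ f) (liftB b) A)

  inst : Formula 1 → Term 0 → Form
  inst A t = subF var (λ _ → t) A

  FSub : Set
  FSub = List (Var × Term 0)

  appS : FSub → Var → Term 0
  appS [] x = var x
  appS ((y , t) ∷ θ) x with x ≟ y
  ... | yes _ = t
  ... | no  _ = appS θ x

  _[_]ₜ : Term 0 → FSub → Term 0
  t [ θ ]ₜ = subT (appS θ) bvar t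

  _[_]f : Form → FSub → Form
  A [ θ ]f = subF (appS θ) bvar A

  _[_]* : List Form → FSub → List Form
  Γ [ θ ]* = map (_[ θ ]f) Γ

  data IsAtomicTerm : Term 0 → Set where
    isVar   : ∀ x → IsAtomicTerm (var x)
    isConst : ∀ f (ts : Vec (Term 0) (funAr f)) → funAr f ≡ 0 → IsAtomicTerm (app f ts)

  AtomicSub : FSub → Set
  AtomicSub θ = ∀ x → IsAtomicTerm (appS θ x)

  data OccT (x : Var) {n : ℕ} : Term n → Set where
    here  : OccT x (var x)
    inApp : ∀ {f ts} → VAny.Any (OccT x) ts → OccT x (app f ts)

  data OccF (x : Var) : {n : ℕ} → Formula n → Set where
    inInd : ∀ {n P} {ts : Vec (Term n) _} → VAny.Any (OccT x) ts → OccF x (indA P ts)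
    inOrd : ∀ {n Q} {ts : Vec (Term n) _} → VAny.Any (OccT x) ts → OccF x (ordA Q ts)
    eqˡ   : ∀ {n} {t u : Term n} → OccT x t → OccF x (t ≐ u)
    eqʳ   : ∀ {n} {t u : Term n} → OccT x u → OccF x (t ≐ u)
    neg   : ∀ {n} {A : Formula n} → OccF x A → OccF x (¬' A)
    orˡ   : ∀ {n} {A B : Formula n} → OccF x A → OccF x (A ∨' B)
    orʳ   : ∀ {n} {A B : Formula n} → OccF x B → OccF x (A ∨' B)
    andˡ  : ∀ {n} {A B : Formula n} → OccF x A → OccF x (A ∧' B)
    andʳ  : ∀ {n} {A B : Formula n} → OccF x B → OccF x (A ∧' B)
    impˡ  : ∀ {n} {A B : Formula n} → OccF x A → OccF x (A ⇒' B)
    impʳ  : ∀ {n} {A B : Formula n} → OccF x B → OccF x (A ⇒' B)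
    ex    : ∀ {n} {A : Formula (suc n)} → OccF x A → OccF x (∃' A)
    all   : ∀ {n} {A : Formula (suc n)} → OccF x A → OccF x (∀' A)

  FreshIn : Var → List Form → Set
  FreshIn x Γ = ∀ {A} → A ∈ Γ → ¬ OccF x A

  data IsIndAtom : Form → Set where
    isInd : ∀ P ts → IsIndAtom (indA P ts)

  -- Productions  Q₁(u₁(x)) … Qₙ(uₙ(x)) P₁(t₁(x)) … Pₘ(tₘ(x)) / P(t(x))
  -- The variables x are the variables occurring in the production.

  record Body (P : Ind) : Set where
    field
      args     : Vec (Term 0) (indAr P)
      ordPrems : List (Σ Ord (λ Q → Vec (Term 0) (ordAr Q)))
      indPrems : List (Σ Ind (λ P' → Vec (Term 0) (indAr P')))

  Production : Set
  Production = Σ Ind Body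

  module _ {P : Ind} (b : Body P) where
    open Body b
    ProdVar : Var → Set
    ProdVar x = VAny.Any (OccT x) args
              ⊎ Any (λ q → VAny.Any (OccT x) (Data.Product.proj₂ q)) ordPrems
              ⊎ Any (λ q → VAny.Any (OccT x) (Data.Product.proj₂ q)) indPrems

    headArgs : (Var → Term 0) → Vec (Term 0) (indAr P)
    headArgs σ = subTs σ bvar args

    ordAtoms : (Var → Term 0) → List Form
    ordAtoms σ = map (λ q → ordA (Data.Product.proj₁ q) (subTs σ bvar (Data.Product.proj₂ q))) ordPrems

    indAtoms : (Var → Term 0) → List Form
    indAtoms σ = map (λ q → indA (Data.Product.proj₁ q) (subTs σ bvar (Data.Product.proj₂ q))) indPrems

  eqs : ∀ {k} → Vec (Term 0) k → Vec (Term 0) k → List Form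
  eqs []       []       = []
  eqs (u ∷ us) (t ∷ ts) = (u ≐ t) ∷ eqs us ts

  -- Sequents (pairs of finite sets, represented by lists)

  infix 3 _⊢_
  record Seq : Set where
    constructor _⊢_
    field
      ante  : List Form
      succe : List Form
  open Seq public

  _≋_ : List Form → List Form → Set
  Γ ≋ Δ = (Γ ⊆ Δ) × (Δ ⊆ Γ)

  _≈ₛ_ : Seq → Seq → Set
  s ≈ₛ s' = (ante s ≋ ante s') × (succe s ≋ succe s')

  ulPrem : (Γ Δ : List Form) (P : Ind) (u : Vec (Term 0) (indAr P)) → (Var → Var) → Body P → Seq
  ulPrem Γ Δ P u ρ b =
    (eqs u (headArgs b (var ∘ ρ)) ++ ordAtoms b (var ∘ ρ) ++ indAtoms b (var ∘ ρ) ++ Γ) ⊢ Δ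

  data CaseList (Γ Δ : List Form) (P : Ind) (u : Vec (Term 0) (indAr P))
       : List Production → List Seq → Set where
    done : CaseList Γ Δ P u [] []
    skip : ∀ {Q b rs ps} → Q ≢ P → CaseList Γ Δ P u rs ps → CaseList Γ Δ P u ((Q , b) ∷ rs) ps
    take : ∀ {b rs ps} (ρ : Var → Var) → Injective _≡_ _≡_ ρ
         → (∀ x → ProdVar b x → FreshIn (ρ x) (indA P u ∷ Γ ++ Δ))
         → CaseList Γ Δ P u rs ps
         → CaseList Γ Δ P u ((P , b) ∷ rs) (ulPrem Γ Δ P u ρ b ∷ ps)

  introAt : ∀ {Γ Δ P u rs ps} → CaseList Γ Δ P u rs ps → ℕ → List Form
  introAt done k = []
  introAt (skip _ c) k = introAt c k
  introAt (take {b = b} ρ _ _ c) zero = indAtoms b (var ∘ ρ)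
  introAt (take ρ _ _ c) (suc k) = introAt c k

module _ {S : Sig} (Φ : List (Syn.Production S)) where
  open Sig S
  open Syn S

  data RName : Set where
    Axiom EqR Wk Cut Subst NegL NegR OrL OrR AndL AndR ImpL ImpR
      AllL AllR ExL ExR EqL UL UR : RName

  data Rule : Seq → List (Seq) → Set where
    ax    : ∀ Γ Δ {A} → A ∈ Γ → A ∈ Δ → Rule (Γ ⊢ Δ) []
    eqR   : ∀ Γ Δ t → Rule (Γ ⊢ (t ≐ t) ∷ Δ) []
    wk    : ∀ Γ Δ Γ' Δ' → Γ' ⊆ Γ → Δ' ⊆ Δ → Rule (Γ ⊢ Δ) ((Γ' ⊢ Δ') ∷ [])
    cut   : ∀ Γ Δ A → Rule (Γ ⊢ Δ) ((Γ ⊢ A ∷ Δ) ∷ (A ∷ Γ ⊢ Δ) ∷ [])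
    subst : ∀ Γ Δ (θ : FSub) → Rule (Γ [ θ ]* ⊢ Δ [ θ ]*) ((Γ ⊢ Δ) ∷ [])
    negL  : ∀ Γ Δ A → Rule (¬' A ∷ Γ ⊢ Δ) ((Γ ⊢ A ∷ Δ) ∷ [])
    negR  : ∀ Γ Δ A → Rule (Γ ⊢ ¬' A ∷ Δ) ((A ∷ Γ ⊢ Δ) ∷ [])
    orL   : ∀ Γ Δ A B → Rule ((A ∨' B) ∷ Γ ⊢ Δ) ((A ∷ Γ ⊢ Δ) ∷ (B ∷ Γ ⊢ Δ) ∷ [])
    orR   : ∀ Γ Δ A B → Rule (Γ ⊢ (A ∨' B) ∷ Δ) ((Γ ⊢ A ∷ B ∷ Δ) ∷ [])
    andL  : ∀ Γ Δ A B → Rule ((A ∧' B) ∷ Γ ⊢ Δ) ((A ∷ B ∷ Γ ⊢ Δ) ∷ [])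
    andR  : ∀ Γ Δ A B → Rule (Γ ⊢ (A ∧' B) ∷ Δ) ((Γ ⊢ A ∷ Δ) ∷ (Γ ⊢ B ∷ Δ) ∷ [])
    impL  : ∀ Γ Δ A B → Rule ((A ⇒' B) ∷ Γ ⊢ Δ) ((Γ ⊢ A ∷ Δ) ∷ (B ∷ Γ ⊢ Δ) ∷ [])
    impR  : ∀ Γ Δ A B → Rule (Γ ⊢ (A ⇒' B) ∷ Δ) ((A ∷ Γ ⊢ B ∷ Δ) ∷ [])
    allL  : ∀ Γ Δ A t → Rule (∀' A ∷ Γ ⊢ Δ) ((inst A t ∷ Γ ⊢ Δ) ∷ [])
    exR   : ∀ Γ Δ A t → Rule (Γ ⊢ ∃' A ∷ Δ) ((Γ ⊢ inst A t ∷ Δ) ∷ [])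
    allR  : ∀ Γ Δ A z → FreshIn z (∀' A ∷ Γ ++ Δ)
          → Rule (Γ ⊢ ∀' A ∷ Δ) ((Γ ⊢ inst A (var z) ∷ Δ) ∷ [])
    exL   : ∀ Γ Δ A z → FreshIn z (∃' A ∷ Γ ++ Δ)
          → Rule (∃' A ∷ Γ ⊢ Δ) ((inst A (var z) ∷ Γ ⊢ Δ) ∷ [])
    eqL   : ∀ Γ Δ x y t u → x ≢ y
          → Rule ((t ≐ u) ∷ Γ [ (x , t) ∷ (y , u) ∷ [] ]* ⊢ Δ [ (x , t) ∷ (y , u) ∷ [] ]*)
                 ((Γ [ (x , u) ∷ (y , t) ∷ [] ]* ⊢ Δ [ (x , u) ∷ (y , t) ∷ [] ]*) ∷ [])
    ul    : ∀ Γ Δ P u {ps} → CaseList Γ Δ P u Φ ps → Rule (indA P u ∷ Γ ⊢ Δ) ps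
    ur    : ∀ Γ Δ P (b : Body P) → (P , b) ∈ Φ → (σ : FSub)
          → Rule (Γ ⊢ indA P (headArgs b (appS σ)) ∷ Δ)
                 (map (λ A → Γ ⊢ A ∷ Δ) (ordAtoms b (appS σ) ++ indAtoms b (appS σ)))

  rname : ∀ {c ps} → Rule c ps → RName
  rname (ax _ _ _ _)          = Axiom
  rname (eqR _ _ _)           = EqR
  rname (wk _ _ _ _ _ _)      = Wk
  rname (cut _ _ _)           = Cut
  rname (subst _ _ _)         = Subst
  rname (negL _ _ _)          = NegL
  rname (negR _ _ _)          = NegR
  rname (orL _ _ _ _)         = OrL
  rname (orR _ _ _ _)         = OrR
  rname (andL _ _ _ _)        = AndL
  rname (andR _ _ _ _)        = AndR
  rname (impL _ _ _ _)        = ImpL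
  rname (impR _ _ _ _)        = ImpR
  rname (allL _ _ _ _)        = AllL
  rname (exR _ _ _ _)         = ExR
  rname (allR _ _ _ _ _)      = AllR
  rname (exL _ _ _ _ _)       = ExL
  rname (eqL _ _ _ _ _ _ _)   = EqL
  rname (ul _ _ _ _ _)        = UL
  rname (ur _ _ _ _ _ _)      = UR

  -- Non-progressing trace correspondence between an antecedent formula C of
  -- the conclusion and an antecedent formula C' of premise number k.
  Corr : ∀ {c ps} → Rule c ps → ℕ → Form → Form → Set
  Corr (ax _ _ _ _) k C C'          = ⊤   -- no premises: never used
  Corr (eqR _ _ _) k C C'           = ⊤   -- no premises: never used
  Corr (wk Γ Δ Γ' Δ' _ _) k C C'    = C ∈ Γ' × C' ≡ C
  Corr (cut Γ Δ A) k C C'           = C ∈ Γ × C' ≡ C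
  Corr (subst Γ Δ θ) k C C'         = C' ∈ Γ × C ≡ C' [ θ ]f
  Corr (negL Γ Δ A) k C C'          = C ∈ Γ × C' ≡ C
  Corr (negR Γ Δ A) k C C'          = C ∈ Γ × C' ≡ C
  Corr (orL Γ Δ A B) k C C'         = C ∈ Γ × C' ≡ C
  Corr (orR Γ Δ A B) k C C'         = C ∈ Γ × C' ≡ C
  Corr (andL Γ Δ A B) k C C'        = C ∈ Γ × C' ≡ C
  Corr (andR Γ Δ A B) k C C'        = C ∈ Γ × C' ≡ C
  Corr (impL Γ Δ A B) k C C'        = C ∈ Γ × C' ≡ C
  Corr (impR Γ Δ A B) k C C'        = C ∈ Γ × C' ≡ C
  Corr (allL Γ Δ A t) k C C'        = C ∈ Γ × C' ≡ C
  Corr (exR Γ Δ A t) k C C'         = C ∈ Γ × C' ≡ C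
  Corr (allR Γ Δ A z _) k C C'      = C ∈ Γ × C' ≡ C
  Corr (exL Γ Δ A z _) k C C'       = C ∈ Γ × C' ≡ C
  Corr (eqL Γ Δ x y t u _) k C C'   =
    ∃[ F ] (F ∈ Γ × C ≡ F [ (x , t) ∷ (y , u) ∷ [] ]f × C' ≡ F [ (x , u) ∷ (y , t) ∷ [] ]f)
  Corr (ul Γ Δ P u _) k C C'        = C ∈ Γ × C' ≡ C
  Corr (ur Γ Δ P b _ σ) k C C'      = C ∈ Γ × C' ≡ C

  -- Progressing trace step: C is the atom unfolded by (UL) and C' is one of
  -- the inductive atoms introduced in premise k.
  Unf : ∀ {c ps} → Rule c ps → ℕ → Form → Form → Set
  Unf (ul Γ Δ P u cl) k C C' = (C ≡ indA P u) × (C' ∈ introAt cl k)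
  Unf _ k C C' = Data.Empty.⊥
    where import Data.Empty

  -- Derivation trees; leaves are 0-premise rule instances or buds.
  -- A node is labelled by a sequent s, and its rule instance has conclusion
  -- c with s ≈ₛ c (sequents are sets).

  data Tree : Seq → Set where
    bud : ∀ {s} → Tree s
    inf : ∀ {s c ps} → Rule c ps → s ≈ₛ c → All Tree ps → Tree s

  mutual
    data At : ∀ {s₀} → Tree s₀ → Addr → ∀ {s} → Tree s → Set where
      here  : ∀ {s} {t : Tree s} → At t [] t
      there : ∀ {s₀ c ps} {r : Rule c ps} {e : s₀ ≈ₛ c} {ks : All Tree ps}
                {k a p s} {t' : Tree p} {t : Tree s}
            → KidAt ks k t' → At t' a t → At (inf r e ks) (k ∷ a) t

    data KidAt : ∀ {ps} → All Tree ps → ℕ → ∀ {p} → Tree p → Set where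
      kz : ∀ {p ps} {t : Tree p} {ts : All Tree ps} → KidAt (t ∷ ts) zero t
      ks : ∀ {p q ps k} {t : Tree p} {t' : Tree q} {ts : All Tree ps}
         → KidAt ts k t → KidAt (t' ∷ ts) (suc k) t

  data InternalWith {s₀} (D : Tree s₀) (a : Addr) (s : Seq) : Set where
    internal : ∀ {s' c ps} {r : Rule c ps} {e : s' ≈ₛ c} {ks : All Tree ps}
             → At D a (inf r e ks) → s' ≈ₛ s → InternalWith D a s

  record PreProof (s₀ : Seq) : Set where
    field
      tree      : Tree s₀
      companion : Addr → Addr
      compOK    : ∀ a {s} → At tree a (bud {s}) → InternalWith tree (companion a) s

  open PreProof public

  module _ {s₀ : Seq} (Pr : PreProof s₀) where

    data Edge : Addr → Addr → Set where
      down : ∀ {a k s c ps p} {r : Rule c ps} {e : s ≈ₛ c} {kids : All Tree ps} {t : Tree p}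
           → At (tree Pr) a (inf r e kids) → KidAt kids k t → Edge a (a ∷ʳ k)
      back : ∀ {a s} → At (tree Pr) a (bud {s}) → Edge a (companion Pr a)

    -- a trace step C → C' along an edge a → a'; the Bool records progress
    data TStep : Addr → Addr → Form → Form → Bool → Set where
      corr : ∀ {a k s c ps p C C'} {r : Rule c ps} {e : s ≈ₛ c} {kids : All Tree ps} {t : Tree p}
           → At (tree Pr) a (inf r e kids) → KidAt kids k t
           → C ∈ ante s → IsIndAtom C → C' ∈ ante p → IsIndAtom C'
           → Corr r k C C' → TStep a (a ∷ʳ k) C C' false
      unf  : ∀ {a k s c ps p C C'} {r : Rule c ps} {e : s ≈ₛ c} {kids : All Tree ps} {t : Tree p}
           → At (tree Pr) a (inf r e kids) → KidAt kids k t
           → C ∈ ante s → IsIndAtom C → C' ∈ ante p → IsIndAtom C'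
           → Unf r k C C' → TStep a (a ∷ʳ k) C C' true
      back : ∀ {a s C} → At (tree Pr) a (bud {s})
           → C ∈ ante s → IsIndAtom C → TStep a (companion Pr a) C C false

    InfinitePath : (ℕ → Addr) → Set
    InfinitePath π = ∀ i → Edge (π i) (π (suc i))

    InfProgTrace : (ℕ → Addr) → ℕ → Set
    InfProgTrace π n =
      Σ (ℕ → Form) λ τ → Σ (ℕ → Bool) λ β →
        (∀ i → TStep (π (i + n)) (π (suc i + n)) (τ i) (τ (suc i)) (β i))
        × (∀ j → ∃[ i ] (j ≤ i × β i ≡ true))

    GlobalTraceCondition : Set
    GlobalTraceCondition = ∀ π → InfinitePath π → ∃[ n ] InfProgTrace π n

    data Uses (n : RName) : Set where
      uses : ∀ {a s c ps} {r : Rule c ps} {e : s ≈ₛ c} {kids : All Tree ps}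
           → At (tree Pr) a (inf r e kids) → rname r ≡ n → Uses n

    CutFree : Set
    CutFree = ¬ Uses Cut

    SubstFree : Set
    SubstFree = ¬ Uses Subst

    AtomicSubsts : Set
    AtomicSubsts = ∀ {a s Γ Δ θ} {e : s ≈ₛ _} {kids : All Tree _}
                 → At (tree Pr) a (inf (subst Γ Δ θ) e kids) → AtomicSub θ

  record CProof (s₀ : Seq) : Set where
    field
      pre : PreProof s₀
      gtc : GlobalTraceCondition pre
  open CProof public

  record CutFreeProof (s₀ : Seq) : Set where
    field
      prf     : CProof s₀
      cutFree : CutFree (pre prf)
  open CutFreeProof public

module Submission where

-- Push the substitutions towards the leaves: a node of the given proof together
-- with an accumulated substitution is a state, labelled by the substituted
-- sequent.  At a (Subst) node the substitution is composed with the accumulated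
-- one, at a bud we pass to the companion, and any other rule is replaced by its
-- substituted instance, with eigenvariables renamed away.  The first two kinds
-- of step make no progress, so by the global trace condition they cannot go on
-- for ever.  As all substitutions are atomic and the fresh eigenvariables can be
-- chosen from a fixed finite set, there are only finitely many states; cutting
-- the unfolding at the first repetition of a state on a branch gives a finite
-- pre-proof.  An infinite path in it projects to an infinite path of the given
-- proof (concatenating the skipped steps), and traces are transferred back by
-- applying the accumulated substitutions.

open import Defs
open import Data.Nat
open import Data.Nat.Properties
open import Data.Fin as F using (Fin; zero; suc; toℕ; fromℕ<)
import Data.Fin.Properties as F
open import Data.Vec using (Vec; []; _∷_)
open import Data.Vec.Relation.Unary.Any as VAny using (here; there)
open import Data.List as L using (List; []; _∷_; map; _++_; _∷ʳ_; length; upTo; allFin; foldr; lookup; concatMap)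
open import Data.List.Properties using (map-∘; map-cong; map-++; ++-assoc; ++-identityʳ; ∷ʳ-injectiveʳ; map-id)
open import Data.List.Membership.Propositional using (_∈_; lose; find)
open import Data.List.Membership.Propositional.Properties
open import Data.List.Relation.Unary.All using (All; []; _∷_)
open import Data.List.Relation.Unary.Any as Any using (Any; here; there)
import Data.List.Relation.Unary.Any.Properties as Any
open import Data.List.Relation.Binary.Subset.Propositional using (_⊆_)
import Data.List.Relation.Binary.Subset.Propositional.Properties as ⊆
open import Data.Product using (Σ; _×_; _,_; ∃; ∃-syntax; proj₁; proj₂; map₁; map₂; swap)
open import Data.Sum using (_⊎_; inj₁; inj₂; [_,_]′)
open import Data.Bool using (Bool; true; false; _∨_)
open import Data.Bool.Properties using (∨-identityʳ; ∨-zeroʳ)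
open import Data.Unit using (tt)
open import Data.Empty using (⊥; ⊥-elim)
open import Relation.Binary.PropositionalEquality as ≡ hiding (subst)
open import Relation.Binary.Construct.Closure.ReflexiveTransitive using (Star; ε; _◅_; _◅◅_)
open import Relation.Nullary
open import Relation.Nullary.Decidable using (map′; _⊎-dec_)
open import Function using (_∘_; id; case_of_)
open import Function.Definitions using (Injective)

-- Finiteness shapes the construction. A rule with eigenvariables survives a substitution only if
-- these are renamed away from the substituted conclusion, and around a cycle a naive choice would
-- use ever new names. Hence only the values at variables occurring in the conclusion are preserved;
-- at each rule all others are overwritten by names from a block that the current values miss.
-- Atomicity matters when a substitution is composed with the accumulated one: the values again lie
-- in a fixed finite pool, whereas compound terms could grow around a cycle. Repetition is tested on
-- states rather than on sequents, so that a bud and its companion stand for the same node of the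
-- given proof with the same accumulated substitution, and traces pass the back edge unchanged.
-- Whether the silent steps end depends on the node alone, since the accumulated substitution does
-- not influence which step comes next.

-- Calculus of substitutions and variable occurrences.

module Syntax (S : Sig) where
  open Syn S

  mutual
    subT-cong : ∀ {n m} {f g : Var → Term m} {b c : Fin n → Term m} (t : Term n)
              → (∀ x → OccT x t → f x ≡ g x) → (∀ i → b i ≡ c i) → subT f b t ≡ subT g c t
    subT-cong (var x) p q = p x here
    subT-cong (bvar i) p q = q i
    subT-cong (app f ts) p q = cong (app f) (subTs-cong ts (λ x → p x ∘ inApp) q)

    subTs-cong : ∀ {n m k} {f g : Var → Term m} {b c : Fin n → Term m} (ts : Vec (Term n) k)
               → (∀ x → VAny.Any (OccT x) ts → f x ≡ g x) → (∀ i → b i ≡ c i)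
               → subTs f b ts ≡ subTs g c ts
    subTs-cong [] p q = refl
    subTs-cong (t ∷ ts) p q =
      cong₂ _∷_ (subT-cong t (λ x → p x ∘ here) q) (subTs-cong ts (λ x → p x ∘ there) q)

  liftB-cong : ∀ {n m} {b c : Fin n → Term m} → (∀ i → b i ≡ c i) → ∀ i → liftB b i ≡ liftB c i
  liftB-cong q zero = refl
  liftB-cong q (suc i) = cong (renT suc) (q i)

  subF-cong : ∀ {n m} {f g : Var → Term m} {b c : Fin n → Term m} (A : Formula n)
            → (∀ x → OccF x A → f x ≡ g x) → (∀ i → b i ≡ c i) → subF f b A ≡ subF g c A
  subF-cong (indA P ts) p q = cong (indA P) (subTs-cong ts (λ x → p x ∘ inInd) q)
  subF-cong (ordA Q ts) p q = cong (ordA Q) (subTs-cong ts (λ x → p x ∘ inOrd) q)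
  subF-cong (t ≐ u) p q =
    cong₂ _≐_ (subT-cong t (λ x → p x ∘ eqˡ) q) (subT-cong u (λ x → p x ∘ eqʳ) q)
  subF-cong (¬' A) p q = cong ¬'_ (subF-cong A (λ x → p x ∘ neg) q)
  subF-cong (A ∨' B) p q =
    cong₂ _∨'_ (subF-cong A (λ x → p x ∘ orˡ) q) (subF-cong B (λ x → p x ∘ orʳ) q)
  subF-cong (A ∧' B) p q =
    cong₂ _∧'_ (subF-cong A (λ x → p x ∘ andˡ) q) (subF-cong B (λ x → p x ∘ andʳ) q)
  subF-cong (A ⇒' B) p q =
    cong₂ _⇒'_ (subF-cong A (λ x → p x ∘ impˡ) q) (subF-cong B (λ x → p x ∘ impʳ) q)
  subF-cong (∃' A) p q =
    cong ∃' (subF-cong A (λ x → cong (renT suc) ∘ p x ∘ ex) (liftB-cong q))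
  subF-cong (∀' A) p q =
    cong ∀' (subF-cong A (λ x → cong (renT suc) ∘ p x ∘ all) (liftB-cong q))

  mutual
    subT-id : ∀ {n} (t : Term n) → subT var bvar t ≡ t
    subT-id (var x) = refl
    subT-id (bvar i) = refl
    subT-id (app f ts) = cong (app f) (subTs-id ts)

    subTs-id : ∀ {n k} (ts : Vec (Term n) k) → subTs var bvar ts ≡ ts
    subTs-id [] = refl
    subTs-id (t ∷ ts) = cong₂ _∷_ (subT-id t) (subTs-id ts)

  liftB-bvar : ∀ {n} (i : Fin (suc n)) → liftB bvar i ≡ bvar i
  liftB-bvar zero = refl
  liftB-bvar (suc i) = refl

  subF-id : ∀ {n} (A : Formula n) → subF var bvar A ≡ A
  subF-id (indA P ts) = cong (indA P) (subTs-id ts)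
  subF-id (ordA Q ts) = cong (ordA Q) (subTs-id ts)
  subF-id (t ≐ u) = cong₂ _≐_ (subT-id t) (subT-id u)
  subF-id (¬' A) = cong ¬'_ (subF-id A)
  subF-id (A ∨' B) = cong₂ _∨'_ (subF-id A) (subF-id B)
  subF-id (A ∧' B) = cong₂ _∧'_ (subF-id A) (subF-id B)
  subF-id (A ⇒' B) = cong₂ _⇒'_ (subF-id A) (subF-id B)
  subF-id (∃' A) = cong ∃' (trans (subF-cong A (λ _ _ → refl) liftB-bvar) (subF-id A))
  subF-id (∀' A) = cong ∀' (trans (subF-cong A (λ _ _ → refl) liftB-bvar) (subF-id A))

  mutual
    subT-renT : ∀ {n m k} (f : Var → Term k) (b : Fin m → Term k) (ρ : Fin n → Fin m) (t : Term n)
              → subT f b (renT ρ t) ≡ subT f (b ∘ ρ) t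
    subT-renT f b ρ (var x) = refl
    subT-renT f b ρ (bvar i) = refl
    subT-renT f b ρ (app g ts) = cong (app g) (subTs-renTs f b ρ ts)

    subTs-renTs : ∀ {n m k l} (f : Var → Term k) (b : Fin m → Term k) (ρ : Fin n → Fin m)
                  (ts : Vec (Term n) l) → subTs f b (renTs ρ ts) ≡ subTs f (b ∘ ρ) ts
    subTs-renTs f b ρ [] = refl
    subTs-renTs f b ρ (t ∷ ts) = cong₂ _∷_ (subT-renT f b ρ t) (subTs-renTs f b ρ ts)

  mutual
    renT-subT : ∀ {n m k} (ρ : Fin m → Fin k) (f : Var → Term m) (b : Fin n → Term m) (t : Term n)
              → renT ρ (subT f b t) ≡ subT (renT ρ ∘ f) (renT ρ ∘ b) t
    renT-subT ρ f b (var x) = refl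
    renT-subT ρ f b (bvar i) = refl
    renT-subT ρ f b (app g ts) = cong (app g) (renTs-subTs ρ f b ts)

    renTs-subTs : ∀ {n m k l} (ρ : Fin m → Fin k) (f : Var → Term m) (b : Fin n → Term m)
                  (ts : Vec (Term n) l)
                → renTs ρ (subTs f b ts) ≡ subTs (renT ρ ∘ f) (renT ρ ∘ b) ts
    renTs-subTs ρ f b [] = refl
    renTs-subTs ρ f b (t ∷ ts) = cong₂ _∷_ (renT-subT ρ f b t) (renTs-subTs ρ f b ts)

  mutual
    subT-subT : ∀ {n m k} (f : Var → Term k) (b : Fin m → Term k)
                (g : Var → Term m) (c : Fin n → Term m) (t : Term n)
              → subT f b (subT g c t) ≡ subT (subT f b ∘ g) (subT f b ∘ c) t
    subT-subT f b g c (var x) = refl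
    subT-subT f b g c (bvar i) = refl
    subT-subT f b g c (app h ts) = cong (app h) (subTs-subTs f b g c ts)

    subTs-subTs : ∀ {n m k l} (f : Var → Term k) (b : Fin m → Term k)
                  (g : Var → Term m) (c : Fin n → Term m) (ts : Vec (Term n) l)
                → subTs f b (subTs g c ts) ≡ subTs (subT f b ∘ g) (subT f b ∘ c) ts
    subTs-subTs f b g c [] = refl
    subTs-subTs f b g c (t ∷ ts) = cong₂ _∷_ (subT-subT f b g c t) (subTs-subTs f b g c ts)

  subT-lift : ∀ {m k} (f : Var → Term k) (b : Fin m → Term k) (t : Term m)
            → subT (renT suc ∘ f) (liftB b) (renT suc t) ≡ renT suc (subT f b t)
  subT-lift f b t = trans (subT-renT _ _ suc t) (sym (renT-subT suc f b t))

  subT-liftB : ∀ {n m k} (f : Var → Term k) (b : Fin m → Term k) (c : Fin n → Term m) i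
             → subT (renT suc ∘ f) (liftB b) (liftB c i) ≡ liftB (subT f b ∘ c) i
  subT-liftB f b c zero = refl
  subT-liftB f b c (suc i) = subT-lift f b (c i)

  subF-subF : ∀ {n m k} (f : Var → Term k) (b : Fin m → Term k)
              (g : Var → Term m) (c : Fin n → Term m) (A : Formula n)
            → subF f b (subF g c A) ≡ subF (subT f b ∘ g) (subT f b ∘ c) A
  subF-subF f b g c (indA P ts) = cong (indA P) (subTs-subTs f b g c ts)
  subF-subF f b g c (ordA Q ts) = cong (ordA Q) (subTs-subTs f b g c ts)
  subF-subF f b g c (t ≐ u) = cong₂ _≐_ (subT-subT f b g c t) (subT-subT f b g c u)
  subF-subF f b g c (¬' A) = cong ¬'_ (subF-subF f b g c A)
  subF-subF f b g c (A ∨' B) = cong₂ _∨'_ (subF-subF f b g c A) (subF-subF f b g c B)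
  subF-subF f b g c (A ∧' B) = cong₂ _∧'_ (subF-subF f b g c A) (subF-subF f b g c B)
  subF-subF f b g c (A ⇒' B) = cong₂ _⇒'_ (subF-subF f b g c A) (subF-subF f b g c B)
  subF-subF f b g c (∃' A) = cong ∃'
    (trans (subF-subF (renT suc ∘ f) (liftB b) (renT suc ∘ g) (liftB c) A)
           (subF-cong A (λ x _ → subT-lift f b (g x)) (subT-liftB f b c)))
  subF-subF f b g c (∀' A) = cong ∀'
    (trans (subF-subF (renT suc ∘ f) (liftB b) (renT suc ∘ g) (liftB c) A)
           (subF-cong A (λ x _ → subT-lift f b (g x)) (subT-liftB f b c)))

  mutual
    occT-ren⁻ : ∀ {n m y} (ρ : Fin n → Fin m) (t : Term n) → OccT y (renT ρ t) → OccT y t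
    occT-ren⁻ ρ (var x) here = here
    occT-ren⁻ ρ (app f ts) (inApp o) = inApp (occTs-ren⁻ ρ ts o)

    occTs-ren⁻ : ∀ {n m y k} (ρ : Fin n → Fin m) (ts : Vec (Term n) k)
               → VAny.Any (OccT y) (renTs ρ ts) → VAny.Any (OccT y) ts
    occTs-ren⁻ ρ (t ∷ ts) (here o) = here (occT-ren⁻ ρ t o)
    occTs-ren⁻ ρ (t ∷ ts) (there o) = there (occTs-ren⁻ ρ ts o)

  mutual
    occT-ren : ∀ {n m y} (ρ : Fin n → Fin m) {t : Term n} → OccT y t → OccT y (renT ρ t)
    occT-ren ρ here = here
    occT-ren ρ (inApp o) = inApp (occTs-ren ρ o)

    occTs-ren : ∀ {n m y k} (ρ : Fin n → Fin m) {ts : Vec (Term n) k}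
              → VAny.Any (OccT y) ts → VAny.Any (OccT y) (renTs ρ ts)
    occTs-ren ρ (here o) = here (occT-ren ρ o)
    occTs-ren ρ (there o) = there (occTs-ren ρ o)

  mutual
    occT-sub : ∀ {n m x y} {f : Var → Term m} {b : Fin n → Term m} {t : Term n}
             → OccT x t → OccT y (f x) → OccT y (subT f b t)
    occT-sub here p = p
    occT-sub (inApp o) p = inApp (occTs-sub o p)

    occTs-sub : ∀ {n m x y k} {f : Var → Term m} {b : Fin n → Term m} {ts : Vec (Term n) k}
              → VAny.Any (OccT x) ts → OccT y (f x) → VAny.Any (OccT y) (subTs f b ts)
    occTs-sub (here o) p = here (occT-sub o p)
    occTs-sub (there o) p = there (occTs-sub o p)

  occF-sub : ∀ {n m x y} {f : Var → Term m} {b : Fin n → Term m} {A : Formula n}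
           → OccF x A → OccT y (f x) → OccF y (subF f b A)
  occF-sub (inInd o) p = inInd (occTs-sub o p)
  occF-sub (inOrd o) p = inOrd (occTs-sub o p)
  occF-sub (eqˡ o) p = eqˡ (occT-sub o p)
  occF-sub (eqʳ o) p = eqʳ (occT-sub o p)
  occF-sub (neg o) p = neg (occF-sub o p)
  occF-sub (orˡ o) p = orˡ (occF-sub o p)
  occF-sub (orʳ o) p = orʳ (occF-sub o p)
  occF-sub (andˡ o) p = andˡ (occF-sub o p)
  occF-sub (andʳ o) p = andʳ (occF-sub o p)
  occF-sub (impˡ o) p = impˡ (occF-sub o p)
  occF-sub (impʳ o) p = impʳ (occF-sub o p)
  occF-sub (ex o) p = ex (occF-sub o (occT-ren suc p))
  occF-sub (all o) p = all (occF-sub o (occT-ren suc p))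

  -- Occurrences after a substitution are traced back to the values of `f` alone, so the values at
  -- bound indices must contribute none.
  Closed : ∀ {n m} → (Fin n → Term m) → Set
  Closed b = ∀ i y → ¬ OccT y (b i)

  liftB-closed : ∀ {n m} {b : Fin n → Term m} → Closed b → Closed (liftB b)
  liftB-closed q (suc i) y o = q i y (occT-ren⁻ suc _ o)

  bvar-closed : ∀ {n} → Closed (bvar {n})
  bvar-closed i y ()

  mutual
    occT-sub⁻ : ∀ {n m y} {f : Var → Term m} {b : Fin n → Term m} → Closed b → (t : Term n)
              → OccT y (subT f b t) → ∃[ x ] (OccT x t × OccT y (f x))
    occT-sub⁻ q (var x) o = x , here , o
    occT-sub⁻ q (bvar i) o = ⊥-elim (q i _ o)
    occT-sub⁻ q (app f ts) (inApp o) = map₂ (map₁ inApp) (occTs-sub⁻ q ts o)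

    occTs-sub⁻ : ∀ {n m y k} {f : Var → Term m} {b : Fin n → Term m} → Closed b
               → (ts : Vec (Term n) k) → VAny.Any (OccT y) (subTs f b ts)
               → ∃[ x ] (VAny.Any (OccT x) ts × OccT y (f x))
    occTs-sub⁻ q (t ∷ ts) (here o) = map₂ (map₁ here) (occT-sub⁻ q t o)
    occTs-sub⁻ q (t ∷ ts) (there o) = map₂ (map₁ there) (occTs-sub⁻ q ts o)

  occF-sub⁻ : ∀ {n m y} {f : Var → Term m} {b : Fin n → Term m} → Closed b → (A : Formula n)
            → OccF y (subF f b A) → ∃[ x ] (OccF x A × OccT y (f x))
  occF-sub⁻ q (indA P ts) (inInd o) = map₂ (map₁ inInd) (occTs-sub⁻ q ts o)
  occF-sub⁻ q (ordA Q ts) (inOrd o) = map₂ (map₁ inOrd) (occTs-sub⁻ q ts o)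
  occF-sub⁻ q (t ≐ u) (eqˡ o) = map₂ (map₁ eqˡ) (occT-sub⁻ q t o)
  occF-sub⁻ q (t ≐ u) (eqʳ o) = map₂ (map₁ eqʳ) (occT-sub⁻ q u o)
  occF-sub⁻ q (¬' A) (neg o) = map₂ (map₁ neg) (occF-sub⁻ q A o)
  occF-sub⁻ q (A ∨' B) (orˡ o) = map₂ (map₁ orˡ) (occF-sub⁻ q A o)
  occF-sub⁻ q (A ∨' B) (orʳ o) = map₂ (map₁ orʳ) (occF-sub⁻ q B o)
  occF-sub⁻ q (A ∧' B) (andˡ o) = map₂ (map₁ andˡ) (occF-sub⁻ q A o)
  occF-sub⁻ q (A ∧' B) (andʳ o) = map₂ (map₁ andʳ) (occF-sub⁻ q B o)
  occF-sub⁻ q (A ⇒' B) (impˡ o) = map₂ (map₁ impˡ) (occF-sub⁻ q A o)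
  occF-sub⁻ q (A ⇒' B) (impʳ o) = map₂ (map₁ impʳ) (occF-sub⁻ q B o)
  occF-sub⁻ q (∃' A) (ex o) with occF-sub⁻ (liftB-closed q) A o
  ... | x , p , r = x , ex p , occT-ren⁻ suc _ r
  occF-sub⁻ q (∀' A) (all o) with occF-sub⁻ (liftB-closed q) A o
  ... | x , p , r = x , all p , occT-ren⁻ suc _ r

  mutual
    occT? : ∀ {n} x (t : Term n) → Dec (OccT x t)
    occT? x (var y) = map′ (λ { refl → here }) (λ { here → refl }) (x ≟ y)
    occT? x (bvar i) = no λ ()
    occT? x (app f ts) = map′ inApp (λ { (inApp o) → o }) (occTs? x ts)

    occTs? : ∀ {n k} x (ts : Vec (Term n) k) → Dec (VAny.Any (OccT x) ts)
    occTs? x [] = no λ ()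
    occTs? x (t ∷ ts) =
      map′ VAny.fromSum VAny.toSum (occT? x t ⊎-dec occTs? x ts)

  occF? : ∀ {n} x (A : Formula n) → Dec (OccF x A)
  occF? x (indA P ts) = map′ inInd (λ { (inInd o) → o }) (occTs? x ts)
  occF? x (ordA Q ts) = map′ inOrd (λ { (inOrd o) → o }) (occTs? x ts)
  occF? x (t ≐ u) =
    map′ [ eqˡ , eqʳ ]′ (λ { (eqˡ o) → inj₁ o ; (eqʳ o) → inj₂ o }) (occT? x t ⊎-dec occT? x u)
  occF? x (¬' A) = map′ neg (λ { (neg o) → o }) (occF? x A)
  occF? x (A ∨' B) =
    map′ [ orˡ , orʳ ]′ (λ { (orˡ o) → inj₁ o ; (orʳ o) → inj₂ o }) (occF? x A ⊎-dec occF? x B)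
  occF? x (A ∧' B) =
    map′ [ andˡ , andʳ ]′ (λ { (andˡ o) → inj₁ o ; (andʳ o) → inj₂ o }) (occF? x A ⊎-dec occF? x B)
  occF? x (A ⇒' B) =
    map′ [ impˡ , impʳ ]′ (λ { (impˡ o) → inj₁ o ; (impʳ o) → inj₂ o }) (occF? x A ⊎-dec occF? x B)
  occF? x (∃' A) = map′ ex (λ { (ex o) → o }) (occF? x A)
  occF? x (∀' A) = map′ all (λ { (all o) → o }) (occF? x A)

  mutual
    boundT : ∀ {n} → Term n → ℕ
    boundT (var x) = suc x
    boundT (bvar i) = 0
    boundT (app f ts) = boundTs ts

    boundTs : ∀ {n k} → Vec (Term n) k → ℕ
    boundTs [] = 0
    boundTs (t ∷ ts) = boundT t ⊔ boundTs ts

  boundF : ∀ {n} → Formula n → ℕ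
  boundF (indA P ts) = boundTs ts
  boundF (ordA Q ts) = boundTs ts
  boundF (t ≐ u) = boundT t ⊔ boundT u
  boundF (¬' A) = boundF A
  boundF (A ∨' B) = boundF A ⊔ boundF B
  boundF (A ∧' B) = boundF A ⊔ boundF B
  boundF (A ⇒' B) = boundF A ⊔ boundF B
  boundF (∃' A) = boundF A
  boundF (∀' A) = boundF A

  mutual
    occT<bound : ∀ {n x} {t : Term n} → OccT x t → x < boundT t
    occT<bound here = ≤-refl
    occT<bound (inApp o) = occTs<bound o

    occTs<bound : ∀ {n x k} {ts : Vec (Term n) k} → VAny.Any (OccT x) ts → x < boundTs ts
    occTs<bound (here {x = t} {xs = ts} o) = m≤n⇒m≤n⊔o (boundTs ts) (occT<bound o)
    occTs<bound (there {x = t} o) = m≤n⇒m≤o⊔n (boundT t) (occTs<bound o)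

  occF<bound : ∀ {n x} {A : Formula n} → OccF x A → x < boundF A
  occF<bound (inInd o) = occTs<bound o
  occF<bound (inOrd o) = occTs<bound o
  occF<bound {A = t ≐ u} (eqˡ o) = m≤n⇒m≤n⊔o (boundT u) (occT<bound o)
  occF<bound {A = t ≐ u} (eqʳ o) = m≤n⇒m≤o⊔n (boundT t) (occT<bound o)
  occF<bound (neg o) = occF<bound o
  occF<bound {A = A ∨' B} (orˡ o) = m≤n⇒m≤n⊔o (boundF B) (occF<bound o)
  occF<bound {A = A ∨' B} (orʳ o) = m≤n⇒m≤o⊔n (boundF A) (occF<bound o)
  occF<bound {A = A ∧' B} (andˡ o) = m≤n⇒m≤n⊔o (boundF B) (occF<bound o)
  occF<bound {A = A ∧' B} (andʳ o) = m≤n⇒m≤o⊔n (boundF A) (occF<bound o)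
  occF<bound {A = A ⇒' B} (impˡ o) = m≤n⇒m≤n⊔o (boundF B) (occF<bound o)
  occF<bound {A = A ⇒' B} (impʳ o) = m≤n⇒m≤o⊔n (boundF A) (occF<bound o)
  occF<bound (ex o) = occF<bound o
  occF<bound (all o) = occF<bound o

  bound : List Form → ℕ
  bound = foldr (λ A n → boundF A ⊔ n) 0

  occ<bound : ∀ {x Γ A} → A ∈ Γ → OccF x A → x < bound Γ
  occ<bound {Γ = A ∷ Γ} (here refl) o = m≤n⇒m≤n⊔o (bound Γ) (occF<bound o)
  occ<bound {Γ = A ∷ Γ} (there p) o = m≤n⇒m≤o⊔n (boundF A) (occ<bound p o)

  _⟪_⟫ : Form → (Var → Term 0) → Form
  A ⟪ σ ⟫ = subF σ bvar A

  _⟪_⟫* : List Form → (Var → Term 0) → List Form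
  Γ ⟪ σ ⟫* = map (_⟪ σ ⟫) Γ

  _⟪_⟫ₛ : Seq → (Var → Term 0) → Seq
  (Γ ⊢ Δ) ⟪ σ ⟫ₛ = Γ ⟪ σ ⟫* ⊢ Δ ⟪ σ ⟫*

  Occ : Var → Seq → Set
  Occ x s = Any (OccF x) (ante s ++ succe s)

  occ? : ∀ x s → Dec (Occ x s)
  occ? x s = Any.any? (occF? x) (ante s ++ succe s)

  occ-ante : ∀ {x A s} → A ∈ ante s → OccF x A → Occ x s
  occ-ante p o = Any.++⁺ˡ (lose p o)

  occ-succe : ∀ {x A s} → A ∈ succe s → OccF x A → Occ x s
  occ-succe {s = s} p o = Any.++⁺ʳ (ante s) (lose p o)
   

  occ-elim : ∀ {x s} → Occ x s → ∃[ A ] ((A ∈ ante s ⊎ A ∈ succe s) × OccF x A)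
  occ-elim {s = s} o with find o
  ... | A , p , q = A , ∈-++⁻ (ante s) p , q

  map-cong∈ : ∀ {f g : Form → Form} Γ → (∀ {A} → A ∈ Γ → f A ≡ g A) → map f Γ ≡ map g Γ
  map-cong∈ [] h = refl
  map-cong∈ (A ∷ Γ) h = cong₂ _∷_ (h (here refl)) (map-cong∈ Γ (h ∘ there))

  seq-cong : ∀ {σ τ} s → (∀ x → Occ x s → σ x ≡ τ x) → s ⟪ σ ⟫ₛ ≡ s ⟪ τ ⟫ₛ
  seq-cong (Γ ⊢ Δ) h = cong₂ _⊢_
    (map-cong∈ Γ λ {A} p → subF-cong A (λ x o → h x (occ-ante p o)) λ _ → refl)
    (map-cong∈ Δ λ {A} p → subF-cong A (λ x o → h x (occ-succe {s = Γ ⊢ Δ} p o)) λ _ → refl)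

  ≈-occ : ∀ {x s s'} → s ≈ₛ s' → Occ x s → Occ x s'
  ≈-occ {s = s} {s'} e o with occ-elim {s = s} o
  ... | A , inj₁ p , q = occ-ante {s = s'} (proj₁ (proj₁ e) p) q
  ... | A , inj₂ p , q = occ-succe {s = s'} (proj₁ (proj₂ e) p) q

  ≈-sym : ∀ {s s'} → s ≈ₛ s' → s' ≈ₛ s
  ≈-sym (a , b) = swap a , swap b

  ≈-refl : ∀ {s} → s ≈ₛ s
  ≈-refl = (id , id) , (id , id)

  ≈-trans : ∀ {s s' s''} → s ≈ₛ s' → s' ≈ₛ s'' → s ≈ₛ s''
  ≈-trans ((a , b) , (c , d)) ((a' , b') , (c' , d')) =
    ((λ x → a' (a x)) , (λ x → b (b' x))) , ((λ x → c' (c x)) , (λ x → d (d' x)))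

  ≈-sub : ∀ {s s'} σ → s ≈ₛ s' → (s ⟪ σ ⟫ₛ) ≈ₛ (s' ⟪ σ ⟫ₛ)
  ≈-sub σ ((a , b) , (c , d)) = (⊆.map⁺ _ a , ⊆.map⁺ _ b) , (⊆.map⁺ _ c , ⊆.map⁺ _ d)

  sub-ind : ∀ {A σ} → IsIndAtom A → IsIndAtom (A ⟪ σ ⟫)
  sub-ind (isInd P ts) = isInd P _

  *-sub : ∀ Γ θ σ → Γ [ θ ]* ⟪ σ ⟫* ≡ Γ ⟪ (λ x → subT σ bvar (appS θ x)) ⟫*
  *-sub Γ θ σ = trans (sym (map-∘ Γ)) (map-cong (λ A → subF-subF σ bvar (appS θ) bvar A) Γ)

  occ-sub⁻ : ∀ {y σ} s → Occ y (s ⟪ σ ⟫ₛ) → ∃[ x ] (Occ x s × OccT y (σ x))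
  occ-sub⁻ {σ = σ} s o with occ-elim {s = s ⟪ σ ⟫ₛ} o
  ... | A' , inj₁ p , q with ∈-map⁻ (_⟪ σ ⟫) p
  ...   | A , m , refl with occF-sub⁻ bvar-closed A q
  ...     | x , r , r' = x , occ-ante {s = s} m r , r'
  occ-sub⁻ {σ = σ} s o | A' , inj₂ p , q with ∈-map⁻ (_⟪ σ ⟫) p
  ...   | A , m , refl with occF-sub⁻ bvar-closed A q
  ...     | x , r , r' = x , occ-succe {s = s} m r , r'

  occ-sub : ∀ {x y σ} s → Occ x s → OccT y (σ x) → Occ y (s ⟪ σ ⟫ₛ)
  occ-sub {σ = σ} s o q with occ-elim {s = s} o
  ... | A , inj₁ m , r = occ-ante {s = s ⟪ σ ⟫ₛ} (∈-map⁺ _ m) (occF-sub r q)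
  ... | A , inj₂ m , r = occ-succe {s = s ⟪ σ ⟫ₛ} (∈-map⁺ _ m) (occF-sub r q)

-- Rule instances under a substitution.

module Instantiation {S : Sig} (Φ : List (Syn.Production S)) where
  open Sig S
  open Syn S
  open Syntax S

  appS-hit : ∀ {x y t} {θ : FSub} → x ≡ y → appS ((y , t) ∷ θ) x ≡ t
  appS-hit {x} {y} p with x ≟ y
  ... | yes _ = refl
  ... | no ¬p = ⊥-elim (¬p p)

  appS-miss : ∀ {x y t} {θ : FSub} → x ≢ y → appS ((y , t) ∷ θ) x ≡ appS θ x
  appS-miss {x} {y} ¬p with x ≟ y
  ... | yes p = ⊥-elim (¬p p)
  ... | no _ = refl

  -- The rule `ur` asks for a finite substitution, while the instance is given by a function. A
  -- production mentions only variables below `prodBound`, so a finite table of values is enough.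
  table : (Var → Term 0) → ℕ → FSub
  table f zero = []
  table f (suc n) = (n , f n) ∷ table f n

  appS-table : ∀ f n {x} → x < n → appS (table f n) x ≡ f x
  appS-table f (suc n) {x} p with x ≟ n
  ... | yes refl = refl
  ... | no x≢n = appS-table f n (≤∧≢⇒< (≤-pred p) x≢n)

  inst-sub : ∀ A t σ → inst A t ⟪ σ ⟫ ≡ inst (subF (renT suc ∘ σ) (liftB bvar) A) (subT σ bvar t)
  inst-sub A t σ = begin
    inst A t ⟪ σ ⟫
      ≡⟨ subF-subF σ bvar var (λ _ → t) A ⟩
    subF σ (λ _ → subT σ bvar t) A
      -- The term `σ x` contains no bound index, so weakening it and then instantiating the index
      -- gives it back.
      ≡⟨ subF-cong A (λ x _ → sym (trans (subT-renT _ _ suc (σ x)) (subT-id' (σ x))))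
                     (λ { zero → refl }) ⟩
    subF (λ x → subT var (λ _ → subT σ bvar t) (renT suc (σ x)))
         (λ i → subT var (λ _ → subT σ bvar t) (liftB bvar i)) A
      ≡⟨ subF-subF var (λ _ → subT σ bvar t) (renT suc ∘ σ) (liftB bvar) A ⟨
    inst (subF (renT suc ∘ σ) (liftB bvar) A) (subT σ bvar t) ∎
    where
    open ≡-Reasoning
    subT-id' : ∀ {b : Fin 0 → Term 0} (u : Term 0) → subT var b u ≡ u
    subT-id' u = trans (subT-cong u (λ _ _ → refl) (λ ())) (subT-id u)

  -- What is needed of σ for the rule instances with conclusion c to be closed
  -- under σ: a variable that does not occur in c (such as an eigenvariable) is
  -- renamed injectively away from c ⟪ σ ⟫ₛ.
  record Admissible (c : Seq) (σ : Var → Term 0) : Set where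
    field
      away      : Var → Var
      injective : Injective _≡_ _≡_ away
      renames   : ∀ v → ¬ Occ v c → σ v ≡ var (away v)
      avoids    : ∀ v → ¬ Occ (away v) (c ⟪ σ ⟫ₛ)

  -- Trace steps are carried only from the given instance to the new one. The premises are a
  -- parameter, so that they can later be rewritten to labels of states.
  record Instance {c ps} (r : Rule Φ c ps) (σ : Var → Term 0) (ps' : List Seq) : Set where
    constructor mk
    field
      rule  : Rule Φ (c ⟪ σ ⟫ₛ) ps'
      name  : rname Φ rule ≡ rname Φ r
      corr⁺ : ∀ {k C C'} → Corr Φ r k C C' → Corr Φ rule k (C ⟪ σ ⟫) (C' ⟪ σ ⟫)
      unf⁺  : ∀ {k C C'} → Unf Φ r k C C' → Unf Φ rule k (C ⟪ σ ⟫) (C' ⟪ σ ⟫)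

  -- For several rules the substituted conclusion or premises have the required shape only up to a
  -- provable equation. Matching the equations once here keeps coercions out of the trace
  -- conditions.
  transport : ∀ {c ps c' ps' σ} {r : Rule Φ c ps} (r' : Rule Φ c' ps')
            → c' ≡ c ⟪ σ ⟫ₛ → ps' ≡ map (_⟪ σ ⟫ₛ) ps → rname Φ r' ≡ rname Φ r
            → (∀ {k C C'} → Corr Φ r k C C' → Corr Φ r' k (C ⟪ σ ⟫) (C' ⟪ σ ⟫))
            → (∀ {k C C'} → Unf Φ r k C C' → Unf Φ r' k (C ⟪ σ ⟫) (C' ⟪ σ ⟫))
            → Instance r σ (map (_⟪ σ ⟫ₛ) ps)
  transport r' refl refl n c u = mk r' n (λ {k} {C} {C'} → c {k} {C} {C'}) (λ {k} {C} {C'} → u {k} {C} {C'})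

  fresh→¬occˡ : ∀ {z F Γ Δ} → FreshIn z (F ∷ Γ ++ Δ) → ¬ Occ z (F ∷ Γ ⊢ Δ)
  fresh→¬occˡ h o with find o
  ... | A , p , q = h p q

  fresh→¬occʳ : ∀ {z F Γ Δ} → FreshIn z (F ∷ Γ ++ Δ) → ¬ Occ z (Γ ⊢ F ∷ Δ)
  fresh→¬occʳ {F = F} {Γ} {Δ} h o with occ-elim {s = Γ ⊢ F ∷ Δ} o
  ... | A , inj₁ p , q = h (there (∈-++⁺ˡ p)) q
  ... | A , inj₂ (here refl) , q = h (here refl) q
  ... | A , inj₂ (there p) , q = h (there (∈-++⁺ʳ Γ p)) q

  ¬occ→freshˡ : ∀ {z F Γ Δ} → ¬ Occ z (F ∷ Γ ⊢ Δ) → FreshIn z (F ∷ Γ ++ Δ)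
  ¬occ→freshˡ h p q = h (lose p q)

  ¬occ→freshʳ : ∀ {z F Γ Δ} → ¬ Occ z (Γ ⊢ F ∷ Δ) → FreshIn z (F ∷ Γ ++ Δ)
  ¬occ→freshʳ {Γ = Γ} {Δ} h (here refl) q = h (occ-succe {s = Γ ⊢ _ ∷ Δ} (here refl) q)
  ¬occ→freshʳ {Γ = Γ} {Δ} h (there p) q with ∈-++⁻ Γ p
  ... | inj₁ p' = h (occ-ante {s = Γ ⊢ _ ∷ Δ} p' q)
  ... | inj₂ p' = h (occ-succe {s = Γ ⊢ _ ∷ Δ} (there p') q)

  eqs-sub : ∀ {k} σ (us ts : Vec (Term 0) k)
          → eqs us ts ⟪ σ ⟫* ≡ eqs (subTs σ bvar us) (subTs σ bvar ts)
  eqs-sub σ [] [] = refl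
  eqs-sub σ (u ∷ us) (t ∷ ts) = cong (_ ∷_) (eqs-sub σ us ts)

  module _ {P : Ind} (b : Body P) where
    open Body b

    module _ {f g : Var → Term 0} (h : ∀ x → ProdVar b x → f x ≡ g x) where
      headArgs-cong : headArgs b f ≡ headArgs b g
      headArgs-cong = subTs-cong args (λ x → h x ∘ inj₁) (λ _ → refl)

      ordAtoms-cong : ordAtoms b f ≡ ordAtoms b g
      ordAtoms-cong = go ordPrems (λ x → h x ∘ inj₂ ∘ inj₁)
        where
        go : ∀ qs → (∀ x → Any (λ q → VAny.Any (OccT x) (proj₂ q)) qs → f x ≡ g x)
           → map (λ q → ordA (proj₁ q) (subTs f bvar (proj₂ q))) qs
           ≡ map (λ q → ordA (proj₁ q) (subTs g bvar (proj₂ q))) qs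
        go [] h = refl
        go ((Q , ts) ∷ qs) h = cong₂ _∷_
          (cong (ordA Q) (subTs-cong ts (λ x → h x ∘ here) (λ _ → refl)))
          (go qs (λ x → h x ∘ there))

      indAtoms-cong : indAtoms b f ≡ indAtoms b g
      indAtoms-cong = go indPrems (λ x → h x ∘ inj₂ ∘ inj₂)
        where
        go : ∀ qs → (∀ x → Any (λ q → VAny.Any (OccT x) (proj₂ q)) qs → f x ≡ g x)
           → map (λ q → indA (proj₁ q) (subTs f bvar (proj₂ q))) qs
           ≡ map (λ q → indA (proj₁ q) (subTs g bvar (proj₂ q))) qs
        go [] h = refl
        go ((Q , ts) ∷ qs) h = cong₂ _∷_
          (cong (indA Q) (subTs-cong ts (λ x → h x ∘ here) (λ _ → refl)))
          (go qs (λ x → h x ∘ there))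

    module _ (σ f : Var → Term 0) where
      headArgs-sub : subTs σ bvar (headArgs b f) ≡ headArgs b (subT σ bvar ∘ f)
      headArgs-sub = subTs-subTs σ bvar f bvar args

      ordAtoms-sub : ordAtoms b f ⟪ σ ⟫* ≡ ordAtoms b (subT σ bvar ∘ f)
      ordAtoms-sub = trans (sym (map-∘ ordPrems))
        (map-cong (λ q → cong (ordA _) (subTs-subTs σ bvar f bvar (proj₂ q))) ordPrems)

      indAtoms-sub : indAtoms b f ⟪ σ ⟫* ≡ indAtoms b (subT σ bvar ∘ f)
      indAtoms-sub = trans (sym (map-∘ indPrems))
        (map-cong (λ q → cong (indA _) (subTs-subTs σ bvar f bvar (proj₂ q))) indPrems)

    -- The premises of a production are bare argument vectors; instantiated with `var` they become
    -- formulas, to which `bound` applies.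
    prodBound : ℕ
    prodBound = boundTs args ⊔ bound (ordAtoms b var) ⊔ bound (indAtoms b var)

    prodVar<bound : ∀ x → ProdVar b x → x < prodBound
    prodVar<bound x (inj₁ o) = m≤n⇒m≤n⊔o _ (m≤n⇒m≤n⊔o _ (occTs<bound o))
    prodVar<bound x (inj₂ (inj₁ o)) with find o
    ... | q , p , o' = m≤n⇒m≤n⊔o _ (m≤n⇒m≤o⊔n (boundTs args)
      (occ<bound (∈-map⁺ _ p) (inOrd (occTs-sub o' here))))
    prodVar<bound x (inj₂ (inj₂ o)) with find o
    ... | q , p , o' = m≤n⇒m≤o⊔n (boundTs args ⊔ bound (ordAtoms b var))
      (occ<bound (∈-map⁺ _ p) (inInd (occTs-sub o' here)))

  module _ {Γ Δ P u σ} (adm : Admissible (indA P u ∷ Γ ⊢ Δ) σ) where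
    open Admissible adm

    -- The eigenvariables `ρ x` of a production do not occur in the conclusion, so `σ` sends them to
    -- `away (ρ x)`. Hence `away ∘ ρ`, injective again, yields exactly the substituted premises. The
    -- equation for `introAt` serves to carry over progressing trace steps.
    cases : ∀ {rs ps} (cl : CaseList Γ Δ P u rs ps)
          → Σ (List Seq) λ ps' →
            Σ (CaseList (Γ ⟪ σ ⟫*) (Δ ⟪ σ ⟫*) P (subTs σ bvar u) rs ps') λ cl' →
            ps' ≡ map (_⟪ σ ⟫ₛ) ps × (∀ k → introAt cl' k ≡ introAt cl k ⟪ σ ⟫*)
    cases done = [] , done , refl , λ _ → refl
    cases (skip ne cl) with cases cl
    ... | ps' , cl' , e , h = ps' , skip ne cl' , e , h
    cases (take {b = b} ρ inj fr cl) with cases cl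
    ... | ps' , cl' , e , h =
      _ , take (away ∘ ρ) (inj ∘ injective) (λ x _ → ¬occ→freshˡ {Γ = Γ ⟪ σ ⟫*} (avoids (ρ x))) cl'
        , cong₂ _∷_ prem e , λ { zero → ind ; (suc k) → h k }
      where
      agree : ∀ x → ProdVar b x → var (away (ρ x)) ≡ σ (ρ x)
      agree x pv = sym (renames (ρ x) (fresh→¬occˡ {Γ = Γ} (fr x pv)))

      ind : indAtoms b (var ∘ away ∘ ρ) ≡ indAtoms b (var ∘ ρ) ⟪ σ ⟫*
      ind = trans (indAtoms-cong b agree) (sym (indAtoms-sub b σ (var ∘ ρ)))

      ord : ordAtoms b (var ∘ away ∘ ρ) ≡ ordAtoms b (var ∘ ρ) ⟪ σ ⟫*
      ord = trans (ordAtoms-cong b agree) (sym (ordAtoms-sub b σ (var ∘ ρ)))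

      eq : eqs (subTs σ bvar u) (headArgs b (var ∘ away ∘ ρ)) ≡ eqs u (headArgs b (var ∘ ρ)) ⟪ σ ⟫*
      eq = trans (cong (eqs _) (trans (headArgs-cong b agree) (sym (headArgs-sub b σ (var ∘ ρ)))))
                 (sym (eqs-sub σ u _))

      prem : ulPrem (Γ ⟪ σ ⟫*) (Δ ⟪ σ ⟫*) P (subTs σ bvar u) (away ∘ ρ) b
           ≡ ulPrem Γ Δ P u ρ b ⟪ σ ⟫ₛ
      prem = cong (_⊢ Δ ⟪ σ ⟫*) (begin
        eqs (subTs σ bvar u) (headArgs b ρ') ++ ordAtoms b ρ' ++ indAtoms b ρ' ++ Γ ⟪ σ ⟫*
          ≡⟨ cong₂ _++_ eq (cong₂ _++_ ord (cong (_++ Γ ⟪ σ ⟫*) ind)) ⟩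
        E ⟪ σ ⟫* ++ O ⟪ σ ⟫* ++ I ⟪ σ ⟫* ++ Γ ⟪ σ ⟫*
          ≡⟨ cong (λ l → E ⟪ σ ⟫* ++ O ⟪ σ ⟫* ++ l) (map-++ _ I Γ) ⟨
        E ⟪ σ ⟫* ++ O ⟪ σ ⟫* ++ (I ++ Γ) ⟪ σ ⟫*
          ≡⟨ cong (E ⟪ σ ⟫* ++_) (map-++ _ O (I ++ Γ)) ⟨
        E ⟪ σ ⟫* ++ (O ++ I ++ Γ) ⟪ σ ⟫*
          ≡⟨ map-++ _ E (O ++ I ++ Γ) ⟨
        (E ++ O ++ I ++ Γ) ⟪ σ ⟫* ∎)
        where
        open ≡-Reasoning
        ρ' = λ x → var (away (ρ x))
        E = eqs u (headArgs b (var ∘ ρ))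
        O = ordAtoms b (var ∘ ρ)
        I = indAtoms b (var ∘ ρ)

  -- The marked variables x and y of (=L) are replaced by K and K + 1, which
  -- lie beyond all variables of the instance.
  module _ (σ : Var → Term 0) (x y : Var) (x≢y : x ≢ y) (K : Var) where
    mark : Var → Term 0
    mark v with v ≟ x | v ≟ y
    ... | yes _ | _ = var K
    ... | no _ | yes _ = var (suc K)
    ... | no _ | no _ = σ v

    -- Since `σ` may send other variables to `x` or `y`, replacing these two after `σ` could hit too
    -- much. The names `K` and `suc K` occur in no relevant value of `σ`, so the new substitution
    -- acts at the marked places only.
    mark-app : ∀ t u v → (∀ w → OccT w (σ v) → w < K)
             → subT (appS ((K , subT σ bvar t) ∷ (suc K , subT σ bvar u) ∷ [])) bvar (mark v)
             ≡ subT σ bvar (appS ((x , t) ∷ (y , u) ∷ []) v)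
    mark-app t u v h = go (v ≟ x) (v ≟ y)
      where
      mark-x : v ≡ x → mark v ≡ var K
      mark-x p with v ≟ x
      ... | yes _ = refl
      ... | no ¬p = ⊥-elim (¬p p)
      mark-y : v ≢ x → v ≡ y → mark v ≡ var (suc K)
      mark-y ¬p q with v ≟ x | v ≟ y
      ... | yes p | _ = ⊥-elim (¬p p)
      ... | no _ | yes _ = refl
      ... | no _ | no ¬q = ⊥-elim (¬q q)
      mark-else : v ≢ x → v ≢ y → mark v ≡ σ v
      mark-else ¬p ¬q with v ≟ x | v ≟ y
      ... | yes p | _ = ⊥-elim (¬p p)
      ... | no _ | yes q = ⊥-elim (¬q q)
      ... | no _ | no _ = refl
      sub' = subT (appS ((K , subT σ bvar t) ∷ (suc K , subT σ bvar u) ∷ [])) bvar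
      go : Dec (v ≡ x) → Dec (v ≡ y)
         → sub' (mark v) ≡ subT σ bvar (appS ((x , t) ∷ (y , u) ∷ []) v)
      go (yes p) _ = trans (cong sub' (mark-x p)) (trans (appS-hit {x = K} {θ = _ ∷ []} refl)
        (cong (subT σ bvar) (sym (appS-hit {θ = _ ∷ []} p))))
      go (no ¬p) (yes q) = trans (cong sub' (mark-y ¬p q))
        (trans (trans (appS-miss {θ = _ ∷ []} (1+n≢n {K})) (appS-hit {x = suc K} {θ = []} refl))
          (cong (subT σ bvar) (sym (trans (appS-miss {θ = _ ∷ []} ¬p) (appS-hit {θ = []} q)))))
      go (no ¬p) (no ¬q) = trans (cong sub' (mark-else ¬p ¬q)) (trans
        (trans (subT-cong (σ v) (λ w o →
            trans (appS-miss {θ = _ ∷ []} (<⇒≢ (h w o)))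
                  (appS-miss {θ = []} (<⇒≢ (m<n⇒m<1+n (h w o))))) (λ _ → refl))
          (subT-id (σ v)))
        (cong (subT σ bvar) (sym (trans (appS-miss {θ = _ ∷ []} ¬p) (appS-miss {θ = []} ¬q)))))

    mark-form : ∀ t u F → (∀ w → OccF w (F ⟪ σ ⟫) → w < K)
              → F ⟪ mark ⟫ [ (K , subT σ bvar t) ∷ (suc K , subT σ bvar u) ∷ [] ]f
              ≡ F [ (x , t) ∷ (y , u) ∷ [] ]f ⟪ σ ⟫
    mark-form t u F h = trans (subF-subF _ bvar mark bvar F)
      (trans (subF-cong F (λ v o → mark-app t u v (λ w o' → h w (occF-sub o o'))) (λ _ → refl))
             (sym (subF-subF σ bvar _ bvar F)))

    mark-forms : ∀ t u Γ → bound (Γ ⟪ σ ⟫*) ≤ K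
               → Γ ⟪ mark ⟫* [ (K , subT σ bvar t) ∷ (suc K , subT σ bvar u) ∷ [] ]*
               ≡ Γ [ (x , t) ∷ (y , u) ∷ [] ]* ⟪ σ ⟫*
    mark-forms t u Γ h = trans (sym (map-∘ Γ)) (trans
      (map-cong∈ Γ (λ {F} p → mark-form t u F
        (λ w o → <-≤-trans (occ<bound (∈-map⁺ _ p) o) h)))
      (map-∘ Γ))

  -- Admissibility is used for `allR`, `exL` and `ul`, the rules with eigenvariables. In `eqL` and
  -- `ur` the obstacle is another one: their finite substitutions have to be rebuilt, by marking and
  -- by `table`.
  instantiate : ∀ {c ps} (r : Rule Φ c ps) {σ} → rname Φ r ≢ Subst → Admissible c σ
              → Instance r σ (map (_⟪ σ ⟫ₛ) ps)
  instantiate (ax Γ Δ p q) ns adm = mk (ax _ _ (∈-map⁺ _ p) (∈-map⁺ _ q)) refl (λ _ → tt) id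
  instantiate (eqR Γ Δ t) ns adm = mk (eqR _ _ _) refl (λ _ → tt) id
  instantiate (wk Γ Δ Γ' Δ' p q) ns adm =
    mk (wk _ _ _ _ (⊆.map⁺ _ p) (⊆.map⁺ _ q)) refl (λ { (p , refl) → ∈-map⁺ _ p , refl }) id
  instantiate (cut Γ Δ A) ns adm = mk (cut _ _ _) refl (λ { (p , refl) → ∈-map⁺ _ p , refl }) id
  instantiate (subst Γ Δ θ) ns adm = ⊥-elim (ns refl)
  instantiate (negL Γ Δ A) ns adm = mk (negL _ _ _) refl (λ { (p , refl) → ∈-map⁺ _ p , refl }) id
  instantiate (negR Γ Δ A) ns adm = mk (negR _ _ _) refl (λ { (p , refl) → ∈-map⁺ _ p , refl }) id
  instantiate (orL Γ Δ A B) ns adm = mk (orL _ _ _ _) refl (λ { (p , refl) → ∈-map⁺ _ p , refl }) id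
  instantiate (orR Γ Δ A B) ns adm = mk (orR _ _ _ _) refl (λ { (p , refl) → ∈-map⁺ _ p , refl }) id
  instantiate (andL Γ Δ A B) ns adm = mk (andL _ _ _ _) refl (λ { (p , refl) → ∈-map⁺ _ p , refl }) id
  instantiate (andR Γ Δ A B) ns adm = mk (andR _ _ _ _) refl (λ { (p , refl) → ∈-map⁺ _ p , refl }) id
  instantiate (impL Γ Δ A B) ns adm = mk (impL _ _ _ _) refl (λ { (p , refl) → ∈-map⁺ _ p , refl }) id
  instantiate (impR Γ Δ A B) ns adm = mk (impR _ _ _ _) refl (λ { (p , refl) → ∈-map⁺ _ p , refl }) id
  instantiate (allL Γ Δ A t) {σ} ns adm =
    transport (allL _ _ _ (subT σ bvar t)) refl
      (cong (λ F → (F ∷ Γ ⟪ σ ⟫* ⊢ Δ ⟪ σ ⟫*) ∷ []) (sym (inst-sub A t σ))) refl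
      (λ { (p , refl) → ∈-map⁺ _ p , refl }) id
  instantiate (exR Γ Δ A t) {σ} ns adm =
    transport (exR _ _ _ (subT σ bvar t)) refl
      (cong (λ F → (Γ ⟪ σ ⟫* ⊢ F ∷ Δ ⟪ σ ⟫*) ∷ []) (sym (inst-sub A t σ))) refl
      (λ { (p , refl) → ∈-map⁺ _ p , refl }) id
  instantiate (allR Γ Δ A z fr) {σ} ns adm =
    transport (allR _ _ _ (away z) (¬occ→freshʳ (avoids z))) refl
      (cong (λ F → (Γ ⟪ σ ⟫* ⊢ F ∷ Δ ⟪ σ ⟫*) ∷ [])
        (trans (cong (inst _) (sym (renames z (fresh→¬occʳ fr)))) (sym (inst-sub A (var z) σ)))) refl
      (λ { (p , refl) → ∈-map⁺ _ p , refl }) id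
    where open Admissible adm
  instantiate (exL Γ Δ A z fr) {σ} ns adm =
    transport (exL _ _ _ (away z) (¬occ→freshˡ {Γ = Γ ⟪ σ ⟫*} (avoids z))) refl
      (cong (λ F → (F ∷ Γ ⟪ σ ⟫* ⊢ Δ ⟪ σ ⟫*) ∷ [])
        (trans (cong (inst _) (sym (renames z (fresh→¬occˡ {Γ = Γ} fr)))) (sym (inst-sub A (var z) σ)))) refl
      (λ { (p , refl) → ∈-map⁺ _ p , refl }) id
    where open Admissible adm
  instantiate (eqL Γ Δ x y t u x≢y) {σ} ns adm =
    transport (eqL (Γ ⟪ mk' ⟫*) (Δ ⟪ mk' ⟫*) K (suc K) (subT σ bvar t) (subT σ bvar u) (1+n≢n {K} ∘ sym))
      (cong₂ (λ Γ' Δ' → ((subT σ bvar t ≐ subT σ bvar u) ∷ Γ') ⊢ Δ')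
        (mark-forms σ x y x≢y K t u Γ bΓ) (mark-forms σ x y x≢y K t u Δ bΔ))
      (cong₂ (λ Γ' Δ' → (Γ' ⊢ Δ') ∷ [])
        (mark-forms σ x y x≢y K u t Γ bΓ) (mark-forms σ x y x≢y K u t Δ bΔ))
      refl
      (λ { (F , p , refl , refl) → F ⟪ mk' ⟫ , ∈-map⁺ _ p , sym (form t u p) , sym (form u t p) })
      id
    where
    -- The terms `t` and `u` do not enter: they are inserted simultaneously and not substituted into
    -- again. So one `K` serves both the conclusion and the premise, where they are swapped.
    K = bound (Γ ⟪ σ ⟫*) ⊔ bound (Δ ⟪ σ ⟫*)
    mk' = mark σ x y x≢y K
    bΓ = m≤m⊔n (bound (Γ ⟪ σ ⟫*)) (bound (Δ ⟪ σ ⟫*))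
    bΔ = m≤n⊔m (bound (Γ ⟪ σ ⟫*)) (bound (Δ ⟪ σ ⟫*))
    form : ∀ t u {F} → F ∈ Γ → F ⟪ mk' ⟫ [ (K , subT σ bvar t) ∷ (suc K , subT σ bvar u) ∷ [] ]f
         ≡ F [ (x , t) ∷ (y , u) ∷ [] ]f ⟪ σ ⟫
    form t u {F} p = mark-form σ x y x≢y K t u F
      (λ w o → <-≤-trans (occ<bound (∈-map⁺ _ p) o) bΓ)
  instantiate (ul Γ Δ P u cl) {σ} ns adm with cases adm cl
  ... | ps' , cl' , e , h =
    transport (ul _ _ P _ cl') refl e refl (λ { (p , refl) → ∈-map⁺ _ p , refl })
      λ { {k} (refl , p) → refl , ≡.subst (_ ∈_) (sym (h k)) (∈-map⁺ _ p) }
  instantiate (ur Γ Δ P b p τ) {σ} ns adm =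
    transport (ur _ _ P b p τ')
      (cong (λ ts → Γ ⟪ σ ⟫* ⊢ indA P ts ∷ Δ ⟪ σ ⟫*)
        (trans (headArgs-cong b agree) (sym (headArgs-sub b σ (appS τ)))))
      -- Forming a premise from a substituted atom and substituting into the premise formed from the
      -- atom are the same function, so both sides are one `map` over `as`.
      (trans (cong (map (λ A → Γ ⟪ σ ⟫* ⊢ A ∷ Δ ⟪ σ ⟫*)) atoms) (trans (sym (map-∘ as)) (map-∘ as)))
      refl (λ { (p , refl) → ∈-map⁺ _ p , refl }) id
    where
    τ' = table (subT σ bvar ∘ appS τ) (prodBound b)
    as = ordAtoms b (appS τ) ++ indAtoms b (appS τ)
    agree : ∀ x → ProdVar b x → appS τ' x ≡ subT σ bvar (appS τ x)
    agree x pv = appS-table _ _ (prodVar<bound b x pv)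
    atoms : ordAtoms b (appS τ') ++ indAtoms b (appS τ') ≡ as ⟪ σ ⟫*
    atoms = trans (cong₂ _++_ (trans (ordAtoms-cong b agree) (sym (ordAtoms-sub b σ (appS τ))))
                              (trans (indAtoms-cong b agree) (sym (indAtoms-sub b σ (appS τ)))))
                  (sym (map-++ _ (ordAtoms b (appS τ)) (indAtoms b (appS τ))))

-- Finite paths and their concatenation into an infinite path.

module _ {A : Set} {R : A → A → Set} where
  steps : ∀ {x y} → Star R x y → ℕ
  steps ε = 0
  steps (e ◅ s) = suc (steps s)

  -- Beyond the end of the path the value stays at the last vertex, which makes the function total.
  at : ∀ {x y} → Star R x y → ℕ → A
  at {x} ε m = x
  at {x} (e ◅ s) zero = x
  at (e ◅ s) (suc m) = at s m

  at-start : ∀ {x y} (s : Star R x y) → at s 0 ≡ x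
  at-start ε = refl
  at-start (e ◅ s) = refl

  steps-◅◅ : ∀ {x y z} (s : Star R x y) (t : Star R y z) → steps (s ◅◅ t) ≡ steps s + steps t
  steps-◅◅ ε t = refl
  steps-◅◅ (e ◅ s) t = cong suc (steps-◅◅ s t)

  at-◅◅ˡ : ∀ {x y z} (s : Star R x y) (t : Star R y z) {m} → m ≤ steps s → at (s ◅◅ t) m ≡ at s m
  at-◅◅ˡ ε t z≤n = at-start t
  at-◅◅ˡ (e ◅ s) t {zero} p = refl
  at-◅◅ˡ (e ◅ s) t {suc m} (s≤s p) = at-◅◅ˡ s t p

  at-◅◅ʳ : ∀ {x y z} (s : Star R x y) (t : Star R y z) m → at (s ◅◅ t) (steps s + m) ≡ at t m
  at-◅◅ʳ ε t m = refl
  at-◅◅ʳ (e ◅ s) t m = at-◅◅ʳ s t m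

  at-edge : ∀ {x y} (s : Star R x y) {m} → m < steps s → R (at s m) (at s (suc m))
  at-edge (e ◅ s) {zero} p = ≡.subst (R _) (sym (at-start s)) e
  at-edge (e ◅ s) {suc m} (s≤s p) = at-edge s p

  module Along {F : Set} (T : A → A → F → F → Bool → Set) (G : A → F → Set) where

    -- A trace along a finite path; the Boolean tells whether some step of it progresses. Evidence
    -- `G` at the end is kept because a back edge of the new proof corresponds to the empty path,
    -- and the trace step on that edge still has to exhibit an inductive atom of the antecedent.
    data Along : ∀ {x y} → Star R x y → F → F → Bool → Set where
      ε   : ∀ {x C} → G x C → Along (ε {x = x}) C C false
      _◅_ : ∀ {x y z C C' C'' b b'} {e : R x y} {s : Star R y z}
          → T x y C C' b → Along s C' C'' b' → Along (e ◅ s) C C'' (b ∨ b')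

    some : (ℕ → Bool) → ℕ → Bool
    some β zero = false
    some β (suc n) = β 0 ∨ some (β ∘ suc) n

    some-true : ∀ β {n k} → k < n → β k ≡ true → some β n ≡ true
    some-true β {suc n} {zero} p q rewrite q = refl
    some-true β {suc n} {suc k} (s≤s p) q rewrite some-true (β ∘ suc) p q = ∨-zeroʳ (β 0)

    along : ∀ {x y} (s : Star R x y) (f : ℕ → F) (β : ℕ → Bool)
          → (∀ k → k < steps s → T (at s k) (at s (suc k)) (f k) (f (suc k)) (β k))
          → (∀ k → k ≤ steps s → G (at s k) (f k))
          → Along s (f 0) (f (steps s)) (some β (steps s))
    along ε f β t g = ε (g 0 z≤n)
    along (e ◅ s) f β t g =
      ≡.subst (λ y → T _ y (f 0) (f 1) (β 0)) (at-start s) (t 0 z<s)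
        ◅ along s (f ∘ suc) (β ∘ suc) (λ k p → t (suc k) (s≤s p)) (λ k p → g (suc k) (s≤s p))

    -- Single segments may be empty, namely those of back edges, but by `moves` never two in a row.
    -- Position `m` of the glued path is therefore reached within `m * 2` segments.
    module Flattening
      (T→G : ∀ {x y C C' b} → T x y C C' b → G x C)
      (x : ℕ → A) (seg : ∀ i → Star R (x i) (x (suc i)))
      (moves : ∀ i → 1 ≤ steps (seg i) + steps (seg (suc i))) where

      prefix : ∀ i → Star R (x 0) (x i)
      prefix zero = ε
      prefix (suc i) = prefix i ◅◅ seg i

      φ : ℕ → ℕ
      φ i = steps (prefix i)

      φ-suc : ∀ i → φ (suc i) ≡ φ i + steps (seg i)
      φ-suc i = steps-◅◅ (prefix i) (seg i)

      φ-≤suc : ∀ i → φ i ≤ φ (suc i)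
      φ-≤suc i = ≤-trans (m≤m+n _ _) (≤-reflexive (sym (φ-suc i)))

      φ-mono : ∀ d i → φ i ≤ φ (d + i)
      φ-mono zero i = ≤-refl
      φ-mono (suc d) i = ≤-trans (φ-mono d i) (φ-≤suc (d + i))

      φ-large : ∀ m → m ≤ φ (m * 2)
      φ-large zero = z≤n
      φ-large (suc m) = begin
        suc m ≤⟨ +-mono-≤ (moves (m * 2)) (φ-large m) ⟩
        (a + b) + φ (m * 2) ≡⟨ +-comm (a + b) _ ⟩
        φ (m * 2) + (a + b) ≡⟨ +-assoc (φ (m * 2)) a b ⟨
        φ (m * 2) + a + b ≡⟨ cong (_+ b) (φ-suc (m * 2)) ⟨
        φ (suc (m * 2)) + b ≡⟨ φ-suc (suc (m * 2)) ⟨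
        φ (suc (suc (m * 2))) ∎
        where
        open ≤-Reasoning
        a = steps (seg (m * 2))
        b = steps (seg (suc (m * 2)))

      -- All prefixes with at least `m` steps agree at `m`; by `φ-large` the first `m * 2` segments
      -- form one.
      π : ℕ → A
      π m = at (prefix (m * 2)) m

      prefix-stable : ∀ d i {m} → m ≤ φ i → at (prefix (d + i)) m ≡ at (prefix i) m
      prefix-stable zero i p = refl
      prefix-stable (suc d) i p =
        trans (at-◅◅ˡ (prefix (d + i)) _ (≤-trans p (φ-mono d i))) (prefix-stable d i p)

      π-prefix : ∀ i {m} → m ≤ φ i → π m ≡ at (prefix i) m
      π-prefix i {m} p with ≤-total i (m * 2)
      ... | inj₁ q = trans (cong (λ j → at (prefix j) m) (sym (m∸n+n≡m q)))
                           (prefix-stable (m * 2 ∸ i) i p)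
      ... | inj₂ q = sym (trans (cong (λ j → at (prefix j) m) (sym (m∸n+n≡m q)))
                                (prefix-stable (i ∸ m * 2) (m * 2) (φ-large m)))

      π-edge : ∀ m → R (π m) (π (suc m))
      π-edge m = ≡.subst (λ y → R y (π (suc m)))
        (sym (π-prefix (suc m * 2) (≤-trans (n≤1+n m) (φ-large (suc m)))))
        (at-edge (prefix (suc m * 2)) (φ-large (suc m)))

      π-seg : ∀ i {k} → k ≤ steps (seg i) → π (φ i + k) ≡ at (seg i) k
      π-seg i {k} p = trans
        (π-prefix (suc i) (≤-trans (+-monoʳ-≤ (φ i) p) (≤-reflexive (sym (φ-suc i)))))
        (at-◅◅ʳ (prefix i) (seg i) k)

      -- Linear search, with range `d`, for the segment containing position `m` of a trace.
      -- Boundaries are shifted by `n` because the trace starts at position `n` of the glued path.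
      bracket : ∀ n m d j → φ j ∸ n ≤ m → m < φ (d + j) ∸ n
              → ∃[ i ] (j ≤ i × φ i ∸ n ≤ m × m < φ (suc i) ∸ n)
      bracket n m zero j p q = ⊥-elim (<-irrefl refl (≤-<-trans p q))
      bracket n m (suc d) j p q with m <? φ (suc j) ∸ n
      ... | yes r = j , ≤-refl , p , r
      ... | no r with bracket n m d (suc j) (≮⇒≥ r)
                        (≡.subst (λ k → m < φ k ∸ n) (sym (+-suc d j)) q)
      ...   | i , a , b , c = i , <⇒≤ a , b , c

      -- By `φ-large`, segment `n * 2` begins no earlier than the trace. From there on the trace is
      -- cut at the segment boundaries, and a segment progresses as soon as one of its steps does.
      transfer : ∀ n (τ : ℕ → F) (β : ℕ → Bool)
               → (∀ i → T (π (i + n)) (π (suc i + n)) (τ i) (τ (suc i)) (β i))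
               → (∀ j → ∃[ i ] (j ≤ i × β i ≡ true))
               → ∃[ i₀ ] Σ (ℕ → F) λ τ' → Σ (ℕ → Bool) λ β' →
                   (∀ i → Along (seg (i + i₀)) (τ' i) (τ' (suc i)) (β' i))
                   × (∀ j → ∃[ i ] (j ≤ i × β' i ≡ true))
      transfer n τ β t often = n * 2 , τ' , β' , trace , progress
        where
        o : ℕ → ℕ
        o i = φ (i + n * 2) ∸ n

        n≤ : ∀ i → n ≤ φ (i + n * 2)
        n≤ i = ≤-trans (φ-large n) (φ-mono i (n * 2))

        τ' : ℕ → F
        τ' i = τ (o i)

        β' : ℕ → Bool
        β' i = some (λ k → β (o i + k)) (steps (seg (i + n * 2)))

        o-suc : ∀ i → o (suc i) ≡ o i + steps (seg (i + n * 2))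
        o-suc i = trans (cong (_∸ n) (φ-suc (i + n * 2))) (+-∸-comm _ (n≤ i))

        pos : ∀ i k → k ≤ steps (seg (i + n * 2)) → π (o i + k + n) ≡ at (seg (i + n * 2)) k
        pos i k p = trans (cong π (begin
          o i + k + n ≡⟨ +-assoc (o i) k n ⟩
          o i + (k + n) ≡⟨ cong (o i +_) (+-comm k n) ⟩
          o i + (n + k) ≡⟨ +-assoc (o i) n k ⟨
          o i + n + k ≡⟨ cong (_+ k) (m∸n+n≡m (n≤ i)) ⟩
          φ (i + n * 2) + k ∎)) (π-seg (i + n * 2) p)
          where open ≡-Reasoning

        trace : ∀ i → Along (seg (i + n * 2)) (τ' i) (τ' (suc i)) (β' i)
        trace i = subst₂ (λ a b → Along (seg (i + n * 2)) (τ a) (τ b) (β' i))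
          (+-identityʳ (o i)) (sym (o-suc i))
          (along (seg (i + n * 2)) (λ k → τ (o i + k)) (λ k → β (o i + k))
            (λ k p → step k p) (λ k p → ≡.subst (λ y → G y (τ (o i + k))) (pos i k p) (T→G (t (o i + k)))))
          where
          step : ∀ k → k < steps (seg (i + n * 2))
               → T (at (seg (i + n * 2)) k) (at (seg (i + n * 2)) (suc k))
                   (τ (o i + k)) (τ (o i + suc k)) (β (o i + k))
          step k p rewrite +-suc (o i) k = subst₂ (λ y z → T y z (τ (o i + k)) (τ (suc (o i + k))) (β (o i + k)))
            (pos i k (<⇒≤ p)) (trans (cong (λ l → π (l + n)) (sym (+-suc (o i) k))) (pos i (suc k) p))
            (t (o i + k))

        progress : ∀ j → ∃[ i ] (j ≤ i × β' i ≡ true)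
        progress j with often (o j)
        ... | m , p , q with bracket n m D (j + n * 2) p large
          where
          -- By `φ-large` this many segments have at least `suc (m + n)` steps, which passes trace
          -- position `m`.
          D = suc (m + n) * 2
          large : m < φ (D + (j + n * 2)) ∸ n
          large = m+n≤o⇒m≤o∸n (suc m) (≤-trans (φ-large (suc (m + n)))
            (≡.subst (λ l → φ D ≤ φ l) (+-comm (j + n * 2) D) (φ-mono (j + n * 2) D)))
        ... | i , a , b , c = i ∸ n * 2 , m+n≤o⇒m≤o∸n j a , found
          where
          i' = i ∸ n * 2
          e : i' + n * 2 ≡ i
          e = m∸n+n≡m (≤-trans (m≤n+m (n * 2) j) a)
          b' : o i' ≤ m
          b' = ≡.subst (λ l → φ l ∸ n ≤ m) (sym e) b
          c' : m < o i' + steps (seg (i' + n * 2))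
          c' = ≡.subst (m <_) (o-suc i') (≡.subst (λ l → m < φ (suc l) ∸ n) (sym e) c)
          found : β' i' ≡ true
          -- The progressing step has offset `m ∸ o i'` in its segment.
          found = some-true (λ k → β (o i' + k))
            (+-cancelˡ-< (o i') _ _ (≡.subst (_< o i' + steps (seg (i' + n * 2))) (sym (m+[n∸m]≡n b')) c'))
            (trans (cong β (m+[n∸m]≡n b')) q)

-- Uniqueness of addresses in derivation trees.

module Trees {S : Sig} (Φ : List (Syn.Production S)) where
  open Syn S
  open Syntax S

  -- An equation of pairs, so that matching on `refl` identifies the sequents together with the
  -- trees.
  kid-unique : ∀ {ps} {ts : All (Tree Φ) ps} {k p p'} {t : Tree Φ p} {t' : Tree Φ p'}
             → KidAt Φ ts k t → KidAt Φ ts k t' → _≡_ {A = Σ Seq (Tree Φ)} (p , t) (p' , t')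
  kid-unique kz kz = refl
  kid-unique (ks p) (ks p') = kid-unique p p'

  at-unique : ∀ {s₀} {D : Tree Φ s₀} {a s s'} {t : Tree Φ s} {t' : Tree Φ s'}
            → At Φ D a t → At Φ D a t' → _≡_ {A = Σ Seq (Tree Φ)} (s , t) (s' , t')
  at-unique here here = refl
  at-unique (there k p) (there k' p') with kid-unique k k'
  ... | refl = at-unique p p'

  at-∷ʳ : ∀ {s₀} {D : Tree Φ s₀} {a s c ps p k} {r : Rule Φ c ps} {e : s ≈ₛ c}
            {ts : All (Tree Φ) ps} {t : Tree Φ p}
        → At Φ D a (inf r e ts) → KidAt Φ ts k t → At Φ D (a ∷ʳ k) t
  at-∷ʳ here k = there k here
  at-∷ʳ (there k' p) k = there k' (at-∷ʳ p k)

  data Link {c ps} (r : Rule Φ c ps) (k : ℕ) (C C' : Form) : Bool → Set where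
    corr : Corr Φ r k C C' → Link r k C C' false
    unf  : Unf Φ r k C C' → Link r k C C' true

  module _ {s₀} (Pr : PreProof Φ s₀) where
    -- A `TStep` brings its own rule instance and premise number. The address determines the former
    -- and the last entry of the extended address the latter, so both are the known ones.
    step-inf : ∀ {a a' C C' b k s c ps} {r : Rule Φ c ps} {e : s ≈ₛ c} {ts : All (Tree Φ) ps}
             → TStep Φ Pr a a' C C' b → At Φ (tree Pr) a (inf r e ts) → a' ≡ a ∷ʳ k
             → C ∈ ante s × IsIndAtom C × Link r k C C' b
    step-inf {a} (corr p _ m i _ _ l) q eq with at-unique p q | ∷ʳ-injectiveʳ a a eq
    ... | refl | refl = m , i , corr l
    step-inf {a} (unf p _ m i _ _ l) q eq with at-unique p q | ∷ʳ-injectiveʳ a a eq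
    ... | refl | refl = m , i , unf l
    step-inf (back p _ _) q eq with at-unique p q
    ... | ()

    step-bud : ∀ {a a' C C' b s} → TStep Φ Pr a a' C C' b → At Φ (tree Pr) a (bud {s = s})
             → C ∈ ante s × IsIndAtom C × C' ≡ C × b ≡ false
    step-bud (corr p _ _ _ _ _ _) q with at-unique p q
    ... | ()
    step-bud (unf p _ _ _ _ _ _) q with at-unique p q
    ... | ()
    step-bud (back p m i) q with at-unique p q
    ... | refl = m , i , refl , refl

-- Folding a finite graph of rule instances into a pre-proof.

data Nth {A : Set} : List A → ℕ → A → Set where
  zero : ∀ {x xs} → Nth (x ∷ xs) 0 x
  suc  : ∀ {x y xs k} → Nth xs k x → Nth (y ∷ xs) (suc k) x

-- Deletion at a given position, as the elements come without an equality test; only `x` can get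
-- lost.
remove : ∀ {A : Set} {x : A} {xs} → x ∈ xs
       → Σ (List A) λ ys → length xs ≡ suc (length ys) × (∀ {y} → y ∈ xs → y ≡ x ⊎ y ∈ ys)
remove {xs = x ∷ xs} (here refl) = xs , refl , λ { (here e) → inj₁ e ; (there q) → inj₂ q }
remove {xs = x ∷ xs} (there p) with remove p
... | ys , e , h = x ∷ ys , cong suc e , λ
  { (here e) → inj₂ (here e)
  ; (there q) → [ inj₁ , (λ r → inj₂ (there r)) ]′ (h q) }

module Fold {S : Sig} (Φ : List (Syn.Production S)) {Q : Set}
  (label concl : Q → Syn.Seq S) (kids : Q → List Q)
  (rule : ∀ q → Rule Φ (concl q) (map label (kids q)))
  (same : ∀ q → Syn._≈ₛ_ S (label q) (concl q))
  (states : List Q) (complete : ∀ q → q ∈ states) where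

  open Syn S
  open Syntax S
  open Trees Φ

  -- anc lists the states met on the way to this point; a leaf is a bud whose
  -- companion is the ancestor with the same state.
  mutual
    data Unfolding (anc : List (Addr × Q)) (a : Addr) (q : Q) : Set where
      leaf : ∀ b → (b , q) ∈ anc → Unfolding anc a q
      node : Forest ((a , q) ∷ anc) a 0 (kids q) → Unfolding anc a q

    data Forest (anc : List (Addr × Q)) (a : Addr) : ℕ → List Q → Set where
      []  : ∀ {k} → Forest anc a k []
      _∷_ : ∀ {k q qs} → Unfolding anc (a ∷ʳ k) q → Forest anc a (suc k) qs
          → Forest anc a k (q ∷ qs)

  -- todo holds the states not yet on the branch, so it shrinks at every node.
  mutual
    unfold : ∀ n (todo : List Q) {anc} a q → length todo ≤ n
           → (∀ q' → q' ∈ todo ⊎ ∃[ b ] (b , q') ∈ anc) → Unfolding anc a q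
    -- The invariant itself decides whether the branch stops here, without comparing states.
    unfold n todo a q h cover with cover q
    ... | inj₂ (b , p) = leaf b p
    unfold zero [] a q h cover | inj₁ ()
    unfold (suc n) todo a q h cover | inj₁ p with remove p
    ... | todo' , e , split = node (unfoldF n todo' a 0 (kids q) (≤-pred (≤-trans (≤-reflexive (sym e)) h))
      λ q' → case cover q' of λ where
        (inj₂ (b , p')) → inj₂ (b , there p')
        (inj₁ p') → case split p' of λ where
          (inj₁ refl) → inj₂ (a , here refl)
          (inj₂ p'') → inj₁ p'')

    unfoldF : ∀ n (todo : List Q) {anc} a k qs → length todo ≤ n
            → (∀ q' → q' ∈ todo ⊎ ∃[ b ] (b , q') ∈ anc) → Forest anc a k qs
    unfoldF n todo a k [] h cover = []
    unfoldF n todo a k (q ∷ qs) h cover =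
      unfold n todo (a ∷ʳ k) q h cover ∷ unfoldF n todo a (suc k) qs h cover

  mutual
    erase : ∀ {anc a q} → Unfolding anc a q → Tree Φ (label q)
    erase (leaf b p) = bud
    erase {q = q} (node f) = inf (rule q) (same q) (eraseF f)

    eraseF : ∀ {anc a k qs} → Forest anc a k qs → All (Tree Φ) (map label qs)
    eraseF [] = []
    eraseF (t ∷ f) = erase t ∷ eraseF f

  mutual
    -- A companion function is total on addresses. Only its values at leaves matter; elsewhere they
    -- are defaults.
    target : ∀ {anc a q} → Unfolding anc a q → Addr → Addr
    target (leaf b p) _ = b
    target (node f) [] = []
    target (node f) (k ∷ c) = targetF f k c

    targetF : ∀ {anc a k qs} → Forest anc a k qs → ℕ → Addr → Addr
    targetF [] k c = []
    targetF (t ∷ f) zero c = target t c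
    targetF (t ∷ f) (suc k) c = targetF f k c

  -- The position `i` counts from the head of the forest, the last address entry `k` from the first
  -- premise. Keeping both as plain indices avoids sums in the types; `in-index` relates them.
  data In {anc a} : ∀ {j qs} → Forest anc a j qs → ℕ → ∀ {k q} → Unfolding anc (a ∷ʳ k) q → Set where
    hd : ∀ {j q qs} {t : Unfolding anc (a ∷ʳ j) q} {f : Forest anc a (suc j) qs} → In (t ∷ f) 0 t
    tl : ∀ {j i k q q' qs} {t : Unfolding anc (a ∷ʳ k) q} {t' : Unfolding anc (a ∷ʳ j) q'}
           {f : Forest anc a (suc j) qs} → In f i t → In (t' ∷ f) (suc i) t

  module _ {anc : List (Addr × Q)} {a : Addr} where
    in-index : ∀ {j qs i k q} {f : Forest anc a j qs} {t : Unfolding anc (a ∷ʳ k) q}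
             → In f i t → k ≡ j + i
    in-index hd = sym (+-identityʳ _)
    in-index {j} (tl p) = trans (in-index p) (sym (+-suc j _))

    in-nth : ∀ {j qs i k q} {f : Forest anc a j qs} {t : Unfolding anc (a ∷ʳ k) q}
           → In f i t → Nth qs i q
    in-nth hd = zero
    in-nth (tl p) = suc (in-nth p)

    in-kid : ∀ {j qs i k q} {f : Forest anc a j qs} {t : Unfolding anc (a ∷ʳ k) q}
           → In f i t → KidAt Φ (eraseF f) i (erase t)
    in-kid hd = kz
    in-kid (tl p) = ks (in-kid p)

    kid-in : ∀ {j qs i s} {t : Tree Φ s} (f : Forest anc a j qs) → KidAt Φ (eraseF f) i t
           → ∃[ k ] ∃[ q ] Σ (Unfolding anc (a ∷ʳ k) q) λ t' →
               In f i t' × _≡_ {A = Σ Seq (Tree Φ)} (s , t) (label q , erase t')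
    kid-in (t ∷ f) kz = _ , _ , t , hd , refl
    kid-in (t ∷ f) (ks p) with kid-in f p
    ... | k , q , t' , m , e = k , q , t' , tl m , e

    in-target : ∀ {j qs i k q} {f : Forest anc a j qs} {t : Unfolding anc (a ∷ʳ k) q}
              → In f i t → ∀ c → targetF f i c ≡ target t c
    in-target hd c = refl
    in-target (tl p) c = in-target p c

  module Folded (q₀ : Q) where
    abstract
      whole : Unfolding [] [] q₀
      whole = unfold (length states) states [] q₀ ≤-refl (λ q → inj₁ (complete q))

    -- In contrast to `At`, this retains the state and the list of ancestors, which `erase` forgets.
    data Sub : ∀ {anc a q} → Unfolding anc a q → Set where
      root : Sub whole
      kid  : ∀ {anc a q i q'} {f : Forest ((a , q) ∷ anc) a 0 (kids q)}
               {t : Unfolding ((a , q) ∷ anc) (a ∷ʳ i) q'}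
           → Sub (node f) → In f i t → Sub t

    sub-at : ∀ {anc a q} {t : Unfolding anc a q} → Sub t → At Φ (erase whole) a (erase t)
    sub-at root = here
    sub-at (kid p m) = at-∷ʳ (sub-at p) (in-kid m)

    sub-target : ∀ {anc a q} {t : Unfolding anc a q} → Sub t → ∀ c → target whole (a ++ c) ≡ target t c
    sub-target root c = refl
    sub-target (kid {a = a} {i = i} p m) c =
      trans (cong (target whole) (++-assoc a (i ∷ []) c))
            (trans (sub-target p (i ∷ c)) (in-target m c))

    -- The list `anc` grows only below a `node`, so walking up the `kid` steps finds the internal
    -- node behind each entry. For a leaf this is its companion.
    ancestor : ∀ {anc a q b q'} {t : Unfolding anc a q} → Sub t → (b , q') ∈ anc
             → ∃[ anc' ] Σ (Forest ((b , q') ∷ anc') b 0 (kids q')) λ f → Sub (node {anc'} f)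
    ancestor (kid p m) (here refl) = _ , _ , p
    ancestor (kid p m) (there r) = ancestor p r

    Located : Addr → Σ Seq (Tree Φ) → Set
    Located a st = ∃[ anc ] ∃[ q ] Σ (Unfolding anc a q) λ t → Sub t × st ≡ (label q , erase t)

    locate-from : ∀ {anc a q c s} {t' : Tree Φ s} {t : Unfolding anc a q}
                → Sub t → At Φ (erase t) c t' → Located (a ++ c) (s , t')
    locate-from {a = a} {t = leaf _ _} p here rewrite ++-identityʳ a = _ , _ , _ , p , refl
    locate-from {a = a} {t = node _} p here rewrite ++-identityʳ a = _ , _ , _ , p , refl
    locate-from {a = a} {t = node f} p (there {k = k} {a = c} m r) with kid-in f m
    ... | k' , q' , t' , m' , refl with in-index m'
    ... | refl = ≡.subst (λ b → Located b _) (++-assoc a (k ∷ []) c) (locate-from (kid p m') r)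

    locate : ∀ {a s} {t : Tree Φ s} → At Φ (erase whole) a t → Located a (s , t)
    locate = locate-from root

    leaf-target : ∀ {anc a q b} {p : (b , q) ∈ anc} → Sub {a = a} (leaf b p) → target whole a ≡ b
    leaf-target {a = a} p = trans (cong (target whole) (sym (++-identityʳ a))) (sub-target p [])

    folded : PreProof Φ (label q₀)
    folded = record
      { tree = erase whole
      ; companion = target whole
      ; compOK = ok }
      where
      ok : ∀ a {s} → At Φ (erase whole) a (bud {s = s})
         → InternalWith Φ (erase whole) (target whole a) s
      ok a p with locate p
      ... | _ , _ , leaf b m , h , refl with ancestor h m
      ...   | _ , f , h' rewrite leaf-target h = internal (sub-at h') ≈-refl
      ok a p | _ , _ , node f , h , ()

    uses-rule : ∀ {n} → Uses Φ folded n → ∃[ q ] rname Φ (rule q) ≡ n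
    uses-rule (uses p e) with locate p
    ... | _ , q , node f , _ , refl = q , e

    -- Edges between unfoldings instead of addresses, so that the states at both ends are visible; a
    -- `jump` keeps the state.
    data Move : ∀ {anc a q anc' a' q'} → Unfolding anc a q → Unfolding anc' a' q' → Set where
      down : ∀ {anc a q i q'} {f : Forest ((a , q) ∷ anc) a 0 (kids q)}
               {t : Unfolding ((a , q) ∷ anc) (a ∷ʳ i) q'}
           → In f i t → Move (node {anc} f) t
      jump : ∀ {anc a q b anc'} {p : (b , q) ∈ anc} {f : Forest ((b , q) ∷ anc') b 0 (kids q)}
           → Move (leaf {anc} {a} b p) (node {anc'} f)

    record Position (a : Addr) : Set where
      constructor at-position
      field
        {ancs} : List (Addr × Q)
        {state} : Q
        {part} : Unfolding ancs a state
        sub : Sub part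
    open Position

    follow : ∀ {a a'} → Edge Φ folded a a' → (p : Position a)
           → Σ (Position a') λ p' → Move (part p) (part p')
    follow (down p m) (at-position {part = leaf _ _} h) with at-unique p (sub-at h)
    ... | ()
    follow (down p m) (at-position {part = node f} h) with at-unique p (sub-at h)
    ... | refl with kid-in f m
    ...   | k , q' , t' , m' , refl with in-index m'
    ...     | refl = at-position (kid h m') , down m'
    follow (back p) (at-position {part = node f} h) with at-unique p (sub-at h)
    ... | ()
    follow (back p) (at-position {part = leaf b m} h) with ancestor h m
    ... | _ , f , h' rewrite leaf-target h = at-position h' , jump

    abstract
      trajectory : ∀ {π} → InfinitePath Φ folded π
                 → Σ (∀ i → Position (π i)) λ pos → ∀ i → Move (part (pos i)) (part (pos (suc i)))
      trajectory {π} path = position , λ i → proj₂ (follow (path i) (position i))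
        where
        start : ∀ {a a'} → Edge Φ folded a a' → Position a
        start (down p _) with locate p
        ... | _ , _ , _ , h , _ = at-position h
        start (back p) with locate p
        ... | _ , _ , _ , h , _ = at-position h
        position : ∀ i → Position (π i)
        position zero = start (path 0)
        position (suc i) = proj₁ (follow (path i) (position i))

    down-step : ∀ {anc a q i q'} {f : Forest ((a , q) ∷ anc) a 0 (kids q)}
                  {t : Unfolding ((a , q) ∷ anc) (a ∷ʳ i) q'} {C C' b}
              → Sub (node f) → In f i t
              → C ∈ ante (label q) → IsIndAtom C → C' ∈ ante (label q') → IsIndAtom C'
              → Link (rule q) i C C' b → TStep Φ folded a (a ∷ʳ i) C C' b
    down-step h m p i p' i' (corr l) = corr (sub-at h) (in-kid m) p i p' i' l
    down-step h m p i p' i' (unf l) = unf (sub-at h) (in-kid m) p i p' i' l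

    jump-step : ∀ {anc a q b} {m : (b , q) ∈ anc} {C}
              → Sub (leaf {anc} {a} b m) → C ∈ ante (label q) → IsIndAtom C
              → TStep Φ folded a b C C false
    jump-step h p i = ≡.subst (λ b → TStep Φ folded _ b _ _ false) (leaf-target h) (back (sub-at h) p i)

-- Enumeration of the nodes, and finite codes for substitutions.

module Nodes {S : Sig} (Φ : List (Syn.Production S)) where
  open Syn S

  record Node {s₀} (D : Tree Φ s₀) : Set where
    constructor node-at
    field
      {addrOf} : Addr
      {seqOf}  : Seq
      {treeOf} : Tree Φ seqOf
      atOf     : At Φ D addrOf treeOf

    place : Addr × Σ Seq (Tree Φ)
    place = addrOf , seqOf , treeOf
  open Node

  KidNode : ∀ {ps} → All (Tree Φ) ps → Set
  KidNode ts = ∃[ k ] ∃[ p ] Σ (Tree Φ p) λ t → KidAt Φ ts k t × Node t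

  mutual
    nodes : ∀ {s₀} (D : Tree Φ s₀) → List (Node D)
    nodes bud = node-at here ∷ []
    nodes (inf r e ts) =
      node-at here ∷ map (λ { (_ , _ , _ , m , node-at p) → node-at (there m p) }) (kidNodes ts)

    kidNodes : ∀ {ps} (ts : All (Tree Φ) ps) → List (KidNode ts)
    kidNodes [] = []
    kidNodes (t ∷ ts) = map (λ n → _ , _ , t , kz , n) (nodes t)
                     ++ map (λ { (k , p , t , m , n) → suc k , p , t , ks m , n }) (kidNodes ts)

  mutual
    nodes-complete : ∀ {s₀} {D : Tree Φ s₀} {a s} {t : Tree Φ s} → At Φ D a t
                   → Any (λ n → place n ≡ (a , s , t)) (nodes D)
    nodes-complete {D = bud} here = here refl
    nodes-complete {D = inf _ _ _} here = here refl
    nodes-complete (there m p) = there (Any.map⁺ (Any.map (λ { (refl , refl) → refl })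
                                                    (kidNodes-complete m p)))

    kidNodes-complete : ∀ {ps} {ts : All (Tree Φ) ps} {k p a s} {t' : Tree Φ p} {t : Tree Φ s}
                      → KidAt Φ ts k t' → At Φ t' a t
                      → Any (λ { (k' , _ , _ , _ , n) → k' ≡ k × place n ≡ (a , s , t) }) (kidNodes ts)
    kidNodes-complete kz p = Any.++⁺ˡ (Any.map⁺ (Any.map (refl ,_) (nodes-complete p)))
    kidNodes-complete {ts = t' ∷ _} (ks m) p =
      Any.++⁺ʳ (map (λ n → _ , _ , t' , kz , n) (nodes t'))
        (Any.map⁺ (Any.map (λ { (refl , e) → refl , e }) (kidNodes-complete m p)))

-- A code stands for a substitution of pool terms for the variables below N.
-- The variables from N on, which never occur in the proof, are sent beyond the
-- pool, so that every decoded substitution is total.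
module Codes {S : Sig} (N : ℕ) (extra : List (Syn.Term S 0))
  (extra-atomic : ∀ {t} → t ∈ extra → Syn.IsAtomicTerm S t) where
  open Syn S
  open Syntax S

  -- N + 1 disjoint blocks of N variables: the N values of a substitution miss
  -- one of them, which then supplies fresh eigenvariables.
  pool : List (Term 0)
  pool = map var (upTo (suc N * N)) ++ extra

  pool-var : ∀ {v} → v < suc N * N → var v ∈ pool
  pool-var p = ∈-++⁺ˡ (∈-map⁺ var (∈-upTo⁺ p))

  pool-extra : ∀ {t} → t ∈ extra → t ∈ pool
  pool-extra = ∈-++⁺ʳ (map var (upTo (suc N * N)))

  N≤ : N ≤ suc N * N
  N≤ = m≤m+n N (N * N)

  pool-atomic : ∀ {t} → t ∈ pool → IsAtomicTerm t
  pool-atomic p with ∈-++⁻ (map var (upTo (suc N * N))) p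
  ... | inj₂ q = extra-atomic q
  ... | inj₁ q with ∈-map⁻ var q
  ...   | v , _ , refl = isVar v

  occ-atomic : ∀ {y t} → IsAtomicTerm t → OccT y t → t ≡ var y
  occ-atomic (isVar x) here = refl
  occ-atomic (isConst f ts e) (inApp o) = ⊥-elim (none ts e o)
    where
    none : ∀ {n y} (ts : Vec (Term 0) n) → n ≡ 0 → ¬ VAny.Any (OccT y) ts
    none [] refl ()

  -- Each pool term `t` enters as the formula `t ≐ t`, to which `bound` applies. The result lies
  -- beyond all block variables and all variables of the pool.
  base : ℕ
  base = suc N * N + bound (map (λ t → t ≐ t) pool)

  pool<base : ∀ {v} → var v ∈ pool → v < base
  pool<base p = ≤-trans (occ<bound (∈-map⁺ (λ t → t ≐ t) p) (eqˡ here)) (m≤n+m _ (suc N * N))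

  Code : Set
  Code = Fin (length pool ^ N)

  decode : Code → Var → Term 0
  decode c v with v <? N
  ... | yes p = lookup pool (F.finToFun c (fromℕ< p))
  ... | no _ = var (v + base)

  decode-pool : ∀ c {v} → v < N → decode c v ∈ pool
  decode-pool c {v} p with v <? N
  ... | yes q = ∈-lookup (F.finToFun c (fromℕ< q))
  ... | no ¬q = ⊥-elim (¬q p)

  decode-out : ∀ c {v} → ¬ v < N → decode c v ≡ var (v + base)
  decode-out c {v} ¬p with v <? N
  ... | yes p = ⊥-elim (¬p p)
  ... | no _ = refl

  module _ (f : Var → Term 0) (h : ∀ v → v < N → f v ∈ pool) where
    private
      index : Fin N → Fin (length pool)
      index i = Any.index (h (toℕ i) (F.toℕ<n i))

    encode : Code
    encode = F.funToFin index

    decode-encode : ∀ {v} → v < N → decode encode v ≡ f v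
    decode-encode {v} p with v <? N
    ... | no ¬q = ⊥-elim (¬q p)
    ... | yes q = begin
      lookup pool (F.finToFun encode (fromℕ< q)) ≡⟨ cong (lookup pool) (F.finToFun-funToFin index (fromℕ< q)) ⟩
      lookup pool (index (fromℕ< q)) ≡⟨ Any.lookup-index (h (toℕ (fromℕ< q)) _) ⟨
      f (toℕ (fromℕ< q)) ≡⟨ cong f (F.toℕ-fromℕ< q) ⟩
      f v ∎
      where open ≡-Reasoning

  block-var : Fin (suc N) → Fin N → Var
  block-var j v = toℕ (F.combine j v)

  Met : Code → Fin (suc N) → Set
  Met c j = ∃[ x ] ∃[ v ] decode c (toℕ {N} x) ≡ var (block-var j v)

  isVar? : ∀ w (t : Term 0) → Dec (t ≡ var w)
  isVar? w (var x) = map′ (cong var) (λ { refl → refl }) (x ≟ w)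
  isVar? w (app f ts) = no λ ()

  -- A variable lies in at most one block, so different met blocks have different witnesses `x`, of
  -- which there are only `N`. As being met is decidable, a missed block can be found.
  free-block : ∀ c → ∃[ j ] ¬ Met c j
  free-block c = F.¬∀⟶∃¬ (suc N) (Met c)
    (λ j → F.any? λ x → F.any? λ v → isVar? (block-var j v) (decode c (toℕ x)))
    λ met → case F.pigeonhole (n<1+n N) (λ j → proj₁ (met j)) of λ where
      (i , j , i<j , e) → <⇒≢ i<j (cong toℕ (F.combine-injectiveˡ i (proj₁ (proj₂ (met i))) j (proj₁ (proj₂ (met j)))
        (F.toℕ-injective (var-injective
          (trans (sym (proj₂ (proj₂ (met i))))
            (trans (cong (λ x → decode c (toℕ x)) e) (proj₂ (proj₂ (met j)))))))))
    where
    var-injective : ∀ {x y} → _≡_ {A = Term 0} (var x) (var y) → x ≡ y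
    var-injective refl = refl

  -- Variables of the conclusion `c` keep their values, so its instance does not change. All others
  -- below `N`, among them any eigenvariables of the rule, move to a block missed by `code`; the
  -- result is again a code.
  module Refresh (Φ : List Production) (c : Seq) (small : ∀ x → Occ x c → x < N) (code : Code) where
    open Instantiation Φ

    block : Fin (suc N)
    block = proj₁ (free-block code)

    away : Var → Var
    away v with v <? N
    ... | yes p = block-var block (fromℕ< p)
    ... | no _ = v + base

    away-pool : ∀ {v} → v < N → var (away v) ∈ pool
    away-pool {v} p with v <? N
    ... | yes q = pool-var (F.toℕ<n (F.combine block (fromℕ< q)))
    ... | no ¬q = ⊥-elim (¬q p)

    away-injective : Injective _≡_ _≡_ away
    away-injective {v} {w} e with v <? N | w <? N
    ... | yes p | yes q =
      F.fromℕ<-injective v w p q (F.combine-injectiveʳ block (fromℕ< p) block (fromℕ< q) (F.toℕ-injective e))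
    ... | no _ | no _ = +-cancelʳ-≡ base v w e
    ... | yes p | no _ = ⊥-elim (<⇒≢ (<-≤-trans (F.toℕ<n (F.combine block (fromℕ< p)))
      (≤-trans (m≤m+n (suc N * N) _) (m≤n+m base w))) e)
    ... | no _ | yes p = ⊥-elim (<⇒≢ (<-≤-trans (F.toℕ<n (F.combine block (fromℕ< p)))
      (≤-trans (m≤m+n (suc N * N) _) (m≤n+m base v))) (sym e))

    away-unmet : ∀ v {x} → x < N → decode code x ≢ var (away v)
    away-unmet v {x} p e with v <? N
    ... | yes q = proj₂ (free-block code)
      (fromℕ< p , fromℕ< q , trans (cong (decode code) (F.toℕ-fromℕ< p)) e)
    ... | no _ = <-irrefl refl
      (<-≤-trans (pool<base (≡.subst (_∈ pool) e (decode-pool code p))) (m≤n+m base v))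

    value : Var → Term 0
    value v with occ? v c
    ... | yes _ = decode code v
    ... | no _ = var (away v)

    value-pool : ∀ v → v < N → value v ∈ pool
    value-pool v p with occ? v c
    ... | yes _ = decode-pool code p
    ... | no _ = away-pool p

    refresh : Code
    refresh = encode value value-pool

    refresh-occ : ∀ x → Occ x c → decode refresh x ≡ decode code x
    refresh-occ x o = trans (decode-encode value value-pool (small x o)) eq
      where
      eq : value x ≡ decode code x
      eq with occ? x c
      ... | yes _ = refl
      ... | no ¬o = ⊥-elim (¬o o)

    refresh-renames : ∀ v → ¬ Occ v c → decode refresh v ≡ var (away v)
    refresh-renames v ¬o = go (v <? N)
      where
      value-away : value v ≡ var (away v)
      value-away with occ? v c
      ... | yes o = ⊥-elim (¬o o)
      ... | no _ = refl
      away-out : ¬ v < N → away v ≡ v + base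
      away-out ¬p with v <? N
      ... | yes p = ⊥-elim (¬p p)
      ... | no _ = refl
      go : Dec (v < N) → decode refresh v ≡ var (away v)
      go (yes p) = trans (decode-encode value value-pool p) value-away
      go (no ¬p) = trans (decode-out refresh ¬p) (cong var (sym (away-out ¬p)))

    admissible : Admissible c (decode refresh)
    admissible = record
      { away = away
      ; injective = away-injective
      ; renames = refresh-renames
      ; avoids = avoids }
      where
      avoids : ∀ v → ¬ Occ (away v) (c ⟪ decode refresh ⟫ₛ)
      avoids v o with occ-sub⁻ c o
      -- The value at `x` is atomic, so an occurrence of `away v` in it makes it equal to that
      -- variable.
      ... | x , p , q = away-unmet v (small x p)
        (occ-atomic (pool-atomic (decode-pool code (small x p)))
          (≡.subst (OccT (away v)) (refresh-occ x p) q))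

-- Silent steps of the given proof.

module SilentSteps {S : Sig} (Φ : List (Syn.Production S)) {s₀ : Syn.Seq S}
  (Pr : CProof Φ s₀) (atomic : AtomicSubsts Φ (pre Pr)) where
  open Syn S
  open Syntax S
  open Instantiation Φ
  open Trees Φ
  open Nodes Φ
  open Node

  Old : PreProof Φ s₀
  Old = pre Pr

  D : Tree Φ s₀
  D = tree Old

  Index : Set
  Index = Fin (length (nodes D))

  node-of : Index → Node D
  node-of = lookup (nodes D)

  adr : Index → Addr
  adr i = addrOf (node-of i)

  sq : Index → Seq
  sq i = seqOf (node-of i)

  tr : ∀ i → Tree Φ (sq i)
  tr i = treeOf (node-of i)

  at-node : ∀ i → At Φ D (adr i) (tr i)
  at-node i = atOf (node-of i)

  index-of : ∀ {a s} {t : Tree Φ s} → At Φ D a t → ∃[ i ] place (node-of i) ≡ (a , s , t)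
  index-of p = Any.index (nodes-complete p) , Any.lookup-index (nodes-complete p)

  formulas : List Form
  formulas = concatMap (λ n → ante (seqOf n) ++ succe (seqOf n)) (nodes D)

  N : ℕ
  N = bound formulas

  occ<N : ∀ i x → Occ x (sq i) → x < N
  occ<N i x o with find o
  ... | A , p , q = occ<bound (∈-concatMap⁺ _ (lose (∈-lookup {xs = nodes D} i) p)) q

  -- This supplies the pool with the constants that substitutions introduce. It may also bring in
  -- variables outside the blocks, which `base` takes into account.
  values : ∀ {s} → Tree Φ s → List (Term 0)
  values (inf (subst Γ Δ θ) e ts) = map (appS θ) (upTo N)
  values _ = []

  values-atomic : ∀ {a s} {t : Tree Φ s} {u} → At Φ D a t → u ∈ values t → IsAtomicTerm u
  values-atomic {t = inf (subst Γ Δ θ) e ts} p m with ∈-map⁻ (appS θ) m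
  ... | x , _ , refl = atomic p x

  extra : List (Term 0)
  extra = concatMap (λ n → values (treeOf n)) (nodes D)

  extra-atomic : ∀ {t} → t ∈ extra → IsAtomicTerm t
  extra-atomic p with find (∈-concatMap⁻ (λ n → values (treeOf n)) {xs = nodes D} p)
  ... | n , _ , m = values-atomic (atOf n) m

  open Codes N extra extra-atomic


  -- The steps that leave no trace in the new proof: along these the sequent
  -- stays the same once the substitution is applied.
  data _⇝_ (i j : Index) : Set where
    jump  : tr i ≡ bud → adr j ≡ companion Old (adr i) → sq j ≈ₛ sq i → i ⇝ j
    strip : ∀ {Γ Δ θ e ts} → tr i ≡ inf (subst Γ Δ θ) e ts
          → adr j ≡ adr i ∷ʳ 0 → sq j ≡ (Γ ⊢ Δ) → i ⇝ j

  record Active (i : Index) : Set where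
    constructor active
    field
      {con}    : Seq
      {prems}  : List Seq
      {rl}     : Rule Φ con prems
      {eq}     : sq i ≈ₛ con
      {kids}   : All (Tree Φ) prems
      tr≡      : tr i ≡ inf rl eq kids
      notSubst : rname Φ rl ≢ Subst

  -- Testing the name spares `view` a case distinction over all other rules.
  isSubst : (n : RName Φ) → Bool
  isSubst Subst = true
  isSubst _ = false

  view : ∀ i → Active i ⊎ ∃[ j ] (i ⇝ j)
  view i = go (tr i) refl
    where
    go : (t : Tree Φ (sq i)) → tr i ≡ t → Active i ⊎ ∃[ j ] (i ⇝ j)
    go bud e with compOK Old (adr i) (≡.subst (At Φ D (adr i)) e (at-node i))
    ... | internal p q with index-of p
    ...   | j , eq = inj₂ (j , jump e (cong proj₁ eq)
      (≡.subst (_≈ₛ sq i) (sym (cong (λ x → proj₁ (proj₂ x)) eq)) q))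
    go (inf r e' ts) e with isSubst (rname Φ r) in isS
    ... | false = inj₁ (active e (λ { x → case trans (sym isS) (cong isSubst x) of λ () }))
    ... | true = inj₂ (sub r ts e isS)
      where
      sub : ∀ {c ps} (r : Rule Φ c ps) {e' : sq i ≈ₛ c} (ts : All (Tree Φ) ps)
          → tr i ≡ inf r e' ts → isSubst (rname Φ r) ≡ true → ∃[ j ] (i ⇝ j)
      sub (subst Γ Δ θ) (t ∷ []) e refl
        with index-of (at-∷ʳ (≡.subst (At Φ D (adr i)) e (at-node i)) kz)
      ... | j , eq = j , strip e (cong proj₁ eq) (cong (λ x → proj₁ (proj₂ x)) eq)

  ⇝-edge : ∀ {i j} → i ⇝ j → Edge Φ Old (adr i) (adr j)
  ⇝-edge {i} (jump e a _) = ≡.subst (Edge Φ Old (adr i)) (sym a)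
    (back (≡.subst (At Φ D (adr i)) e (at-node i)))
  ⇝-edge {i} (strip {ts = t ∷ []} e a _) = ≡.subst (Edge Φ Old (adr i)) (sym a)
    (down (≡.subst (At Φ D (adr i)) e (at-node i)) kz)

  ⇝-stutters : ∀ {i j C C' b} → i ⇝ j → TStep Φ Old (adr i) (adr j) C C' b → b ≡ false
  ⇝-stutters {i} (jump e _ _) t with step-bud Old t (≡.subst (At Φ D (adr i)) e (at-node i))
  ... | _ , _ , _ , f = f
  ⇝-stutters {i} (strip e a _) t with step-inf Old t (≡.subst (At Φ D (adr i)) e (at-node i)) a
  ... | _ , _ , corr _ = refl

  next : Index → Index
  next i = [ (λ _ → i) , proj₁ ]′ (view i)

  iter : ℕ → Index → Index
  iter zero i = i
  iter (suc n) i = iter n (next i)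

  iter-+ : ∀ m n i → iter (m + n) i ≡ iter n (iter m i)
  iter-+ zero n i = refl
  iter-+ (suc m) n i = iter-+ m n (next i)

  Quiet : Index → Set
  Quiet i = i ⇝ next i

  not-always-quiet : ∀ i → ¬ (∀ n → Quiet (iter n i))
  not-always-quiet i quiet = contra (gtc Pr (λ n → adr (iter n i)) (λ n → ⇝-edge (step n)))
    where
    step : ∀ n → iter n i ⇝ iter (suc n) i
    step n = ≡.subst (iter n i ⇝_)
      (trans (sym (iter-+ n 1 i)) (cong (λ k → iter k i) (+-comm n 1))) (quiet n)
    contra : ∃ (InfProgTrace Φ Old (λ n → adr (iter n i))) → ⊥
    contra (n , τ , β , t , often) with often 0
    ... | k , _ , p = case trans (sym p) (⇝-stutters (step (k + n)) (t k)) of λ ()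

  -- The global trace condition refutes only an infinite run, while `settle` inspects finitely many
  -- steps. There are `length (nodes D)` nodes, so by the pigeonhole principle every iterate already
  -- appears among those inspected.
  quiet-forever : ∀ i → (∀ n → n ≤ length (nodes D) → Quiet (iter n i)) → ∀ n → Quiet (iter n i)
  quiet-forever i quiet n with early n
    where
    K = length (nodes D)
    early : ∀ n → ∃[ m ] (m ≤ K × iter n i ≡ iter m i)
    early zero = 0 , z≤n , refl
    early (suc n) with early n
    ... | m , p , e with m <? K
    ...   | yes q = suc m , q , trans (cong (λ k → iter k i) (+-comm 1 n)) (trans (iter-+ n 1 i)
            (trans (cong next e) (trans (sym (iter-+ m 1 i)) (cong (λ k → iter k i) (+-comm m 1)))))
    -- Here the next iterate would have number `suc K`. A repetition at `a < b` among the numbers up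
    -- to `K` lets the stretch from `b` to `suc K`, of length `d`, start at `a` instead.
    ...   | no ¬q with F.pigeonhole (n<1+n K) (λ (l : Fin (suc K)) → iter (toℕ l) i)
    ...     | a , b , a<b , e' = toℕ a + d , bnd , (begin
      iter (suc n) i ≡⟨ cong (λ k → iter k i) (+-comm 1 n) ⟩
      iter (n + 1) i ≡⟨ iter-+ n 1 i ⟩
      next (iter n i) ≡⟨ cong next e ⟩
      next (iter m i) ≡⟨ iter-+ m 1 i ⟨
      iter (m + 1) i ≡⟨ cong (λ k → iter k i) (trans (+-comm m 1) (cong suc m≡K)) ⟩
      iter (suc K) i ≡⟨ cong (λ k → iter k i) (m+[n∸m]≡n b≤) ⟨
      iter (toℕ b + d) i ≡⟨ iter-+ (toℕ b) d i ⟩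
      iter d (iter (toℕ b) i) ≡⟨ cong (iter d) e' ⟨
      iter d (iter (toℕ a) i) ≡⟨ iter-+ (toℕ a) d i ⟨
      iter (toℕ a + d) i ∎)
      where
      open ≡-Reasoning
      d = suc K ∸ toℕ b
      m≡K : m ≡ K
      m≡K = ≤-antisym p (≮⇒≥ ¬q)
      b≤ : toℕ b ≤ suc K
      b≤ = <⇒≤ (F.toℕ<n b)
      bnd : toℕ a + d ≤ K
      bnd = ≤-pred (<-≤-trans (+-monoˡ-< d a<b) (≤-reflexive (m+[n∸m]≡n b≤)))
  ... | m , p , e = ≡.subst Quiet (sym e) (quiet m p)

  settle-or-quiet : ∀ n i → (∃[ j ] (Star _⇝_ i j × Active j)) ⊎ (∀ m → m < n → Quiet (iter m i))
  settle-or-quiet zero i = inj₂ λ m ()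
  settle-or-quiet (suc n) i with view i in eq
  ... | inj₁ a = inj₁ (i , ε , a)
  ... | inj₂ (j , s) with settle-or-quiet n j
  ...   | inj₁ (k , c , a) = inj₁ (k , s ◅ c , a)
  ...   | inj₂ q = inj₂ λ { zero _ → ≡.subst (i ⇝_) (sym e) s
                          ; (suc m) (s≤s p) → ≡.subst (λ l → Quiet (iter m l)) (sym e) (q m p) }
    where
    e : next i ≡ j
    e = cong [ (λ _ → i) , proj₁ ]′ eq

  abstract
    settle : ∀ i → ∃[ j ] (Star _⇝_ i j × Active j)
    settle i with settle-or-quiet (suc (length (nodes D))) i
    ... | inj₁ r = r
    ... | inj₂ q = ⊥-elim (not-always-quiet i (quiet-forever i (λ n p → q n (s≤s p))))

-- States and their expansion to rule instances.

module Elimination {S : Sig} (Φ : List (Syn.Production S)) {s₀ : Syn.Seq S}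
  (Pr : CProof Φ s₀) (atomic : AtomicSubsts Φ (pre Pr)) where
  open Syn S
  open Syntax S
  open Instantiation Φ
  open Trees Φ
  open Nodes Φ
  open SilentSteps Φ Pr atomic
  open Codes N extra extra-atomic

  module Strip {i j Γ Δ θ e ts} (tr≡ : tr i ≡ inf (subst Γ Δ θ) e ts)
               (sq≡ : sq j ≡ (Γ ⊢ Δ)) (c : Code) where
    composite : Var → Term 0
    composite x = subT (decode c) bvar (appS θ x)

    small : ∀ x → Occ x (Γ ⊢ Δ) → x < N
    small x o = occ<N j x (≡.subst (Occ x) (sym sq≡) o)

    -- Atomicity keeps the states finite here. If `θ` sends `x` to a variable `w`, then `w` occurs
    -- in the conclusion, so `w < N` and its value is in the pool. A constant is left alone by
    -- `decode c` and was put into `extra`.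
    composite-pool : ∀ x → Occ x (Γ ⊢ Δ) → composite x ∈ pool
    composite-pool x o = go (appS θ x) refl (atomic (≡.subst (At Φ D (adr i)) tr≡ (at-node i)) x)
      where
      constant : ∀ {n} (ts : Vec (Term 0) n) → n ≡ 0 → subTs (decode c) bvar ts ≡ ts
      constant [] refl = refl
      go : ∀ t → appS θ x ≡ t → IsAtomicTerm t → subT (decode c) bvar t ∈ pool
      go (var w) eq (isVar w) = decode-pool c (occ<N i w (≈-occ (≈-sym e)
        (occ-sub (Γ ⊢ Δ) o (≡.subst (OccT w) (sym eq) here))))
      go (app f ts) eq (isConst f ts f≡0) =
        ≡.subst (_∈ pool) (cong (app f) (sym (constant ts f≡0)))
          (pool-extra (∈-concatMap⁺ (λ n → values (Node.treeOf n)) (lose (∈-lookup {xs = nodes D} i)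
            (≡.subst (λ t → app f ts ∈ values t) (sym tr≡)
              (≡.subst (_∈ map (appS θ) (upTo N)) eq (∈-map⁺ (appS θ) (∈-upTo⁺ (small x o))))))))

    value : Var → Term 0
    value x with occ? x (Γ ⊢ Δ)
    ... | yes _ = composite x
    -- Absent variables do not influence the label of the premise; any pool term would serve.
    ... | no _ = var x

    value-pool : ∀ x → x < N → value x ∈ pool
    value-pool x p with occ? x (Γ ⊢ Δ)
    ... | yes o = composite-pool x o
    ... | no _ = pool-var (<-≤-trans p N≤)

    code : Code
    code = encode value value-pool

    decode-code : ∀ x → Occ x (Γ ⊢ Δ) → composite x ≡ decode code x
    decode-code x o = sym (trans (decode-encode value value-pool (small x o)) eq)
      where
      eq : value x ≡ composite x
      eq with occ? x (Γ ⊢ Δ)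
      ... | yes _ = refl
      ... | no ¬o = ⊥-elim (¬o o)

    label≈ : (sq i ⟪ decode c ⟫ₛ) ≈ₛ (sq j ⟪ decode code ⟫ₛ)
    label≈ = ≡.subst ((sq i ⟪ decode c ⟫ₛ) ≈ₛ_)
      (trans (cong₂ _⊢_ (*-sub Γ θ (decode c)) (*-sub Δ θ (decode c)))
        (trans (seq-cong (Γ ⊢ Δ) decode-code) (cong (_⟪ decode code ⟫ₛ) (sym sq≡))))
      (≈-sub (decode c) e)

    formula≡ : ∀ {C} → C ∈ Γ → C [ θ ]f ⟪ decode c ⟫ ≡ C ⟪ decode code ⟫
    formula≡ {C} m = trans (subF-subF (decode c) bvar (appS θ) bvar C)
      (subF-cong C (λ x o → decode-code x (occ-ante {s = Γ ⊢ Δ} m o)) (λ _ → refl))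

  push : ∀ {i j} → i ⇝ j → Code → Code
  push (jump _ _ _) c = c
  push {i} {j} (strip e _ s) c = Strip.code {i} {j} e s c

  push-label : ∀ {i j} (s : i ⇝ j) c → (sq i ⟪ decode c ⟫ₛ) ≈ₛ (sq j ⟪ decode (push s c) ⟫ₛ)
  push-label {i} {j} (jump _ _ q) c = ≈-sub (decode c) (≈-sym {sq j} {sq i} q)
  push-label {i} {j} (strip e _ s) c = Strip.label≈ {i} {j} e s c

  -- Silent steps are invisible to traces: under the accumulated substitutions both formulas become
  -- the same one.
  push-step : ∀ {i j C C' b} (s : i ⇝ j) c → TStep Φ Old (adr i) (adr j) C C' b
            → C ⟪ decode c ⟫ ≡ C' ⟪ decode (push s c) ⟫
  push-step {i} (jump e _ _) c t with step-bud Old t (≡.subst (At Φ D (adr i)) e (at-node i))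
  ... | _ , _ , refl , _ = refl
  push-step {i} {j} (strip e a s) c t with step-inf Old t (≡.subst (At Φ D (adr i)) e (at-node i)) a
  ... | _ , _ , corr (m , refl) = Strip.formula≡ {i} {j} e s c m

  pushes : ∀ {i j} → Star _⇝_ i j → Code → Code
  pushes ε c = c
  pushes (s ◅ ch) c = pushes ch (push s c)

  pushes-label : ∀ {i j} (ch : Star _⇝_ i j) c → (sq i ⟪ decode c ⟫ₛ) ≈ₛ (sq j ⟪ decode (pushes ch c) ⟫ₛ)
  pushes-label {i} ε c = ≈-refl {sq i ⟪ decode c ⟫ₛ}
  pushes-label {i} {j} (_◅_ {j = k} s ch) c =
    ≈-trans {sq i ⟪ decode c ⟫ₛ} {sq k ⟪ decode (push s c) ⟫ₛ} {sq j ⟪ decode (pushes ch (push s c)) ⟫ₛ}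
      (push-label s c) (pushes-label ch (push s c))

  edges : ∀ {i j} → Star _⇝_ i j → Star (Edge Φ Old) (adr i) (adr j)
  edges ε = ε
  edges (s ◅ ch) = ⇝-edge s ◅ edges ch

  Live : Addr → Form → Set
  Live a C = ∃[ s ] Σ (Tree Φ s) λ t → At Φ D a t × C ∈ ante s × IsIndAtom C

  step-live : ∀ {a a' C C' b} → TStep Φ Old a a' C C' b → Live a C
  step-live (corr p _ m i _ _ _) = _ , _ , p , m , i
  step-live (unf p _ m i _ _ _) = _ , _ , p , m , i
  step-live (back p m i) = _ , _ , p , m , i

  live-node : ∀ {i C} → Live (adr i) C → C ∈ ante (sq i) × IsIndAtom C
  live-node {i} (s , t , p , m , ind) with at-unique p (at-node i)
  ... | refl = m , ind

  open Along {R = Edge Φ Old} (TStep Φ Old) Live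

  -- The silent part contributes no progress, so `b` is decided by `rest` alone.
  pushes-along : ∀ {i j a C C' b} (ch : Star _⇝_ i j) c {rest : Star (Edge Φ Old) (adr j) a}
               → Along (edges ch ◅◅ rest) C C' b
               → ∃[ C₁ ] (C ⟪ decode c ⟫ ≡ C₁ ⟪ decode (pushes ch c) ⟫ × Along rest C₁ C' b)
  pushes-along ε c al = _ , refl , al
  pushes-along (s ◅ ch) c (t ◅ al) with pushes-along ch (push s c) al
  ... | C₁ , e , al' with ⇝-stutters s t
  ...   | refl = C₁ , trans (push-step s c t) e , al'

  State : Set
  State = Index × Code

  label : State → Seq
  label (i , c) = sq i ⟪ decode c ⟫ₛ

  -- The address function is a parameter so that recursion over the premises can shift the
  -- numbering.
  KidIndices : (ℕ → Addr) → ∀ {ps} → All (Tree Φ) ps → Set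
  KidIndices f ts = ∀ {k p} {t : Tree Φ p} → KidAt Φ ts k t → ∃[ l ] (adr l ≡ f k × sq l ≡ p)

  kidIndices : ∀ f {ps} (ts : All (Tree Φ) ps) → KidIndices f ts → List Index
  kidIndices f [] h = []
  kidIndices f (t ∷ ts) h = proj₁ (h kz) ∷ kidIndices (f ∘ suc) ts (λ m → h (ks m))

  kidIndices-sq : ∀ f {ps} (ts : All (Tree Φ) ps) (h : KidIndices f ts) → map sq (kidIndices f ts h) ≡ ps
  kidIndices-sq f [] h = refl
  kidIndices-sq f (t ∷ ts) h = cong₂ _∷_ (proj₂ (proj₂ (h kz)))
    (kidIndices-sq (f ∘ suc) ts (λ m → h (ks m)))

  kidIndices-nth : ∀ f {ps} (ts : All (Tree Φ) ps) (h : KidIndices f ts) {k l}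
                 → Nth (kidIndices f ts h) k l
                 → ∃[ p ] Σ (Tree Φ p) λ t → KidAt Φ ts k t × adr l ≡ f k
  kidIndices-nth f (t ∷ ts) h zero = _ , t , kz , proj₁ (proj₂ (h kz))
  kidIndices-nth f (t ∷ ts) h (suc n) with kidIndices-nth (f ∘ suc) ts (λ m → h (ks m)) n
  ... | _ , t' , m , e = _ , t' , ks m , e

  nth-map : ∀ {A B : Set} (g : A → B) {xs k y} → Nth (map g xs) k y → ∃[ x ] (Nth xs k x × y ≡ g x)
  nth-map g {x ∷ xs} zero = x , zero , refl
  nth-map g {x ∷ xs} (suc n) with nth-map g {xs} n
  ... | x' , n' , e = x' , suc n' , e

  -- The data that `down-step` needs for a trace step of the new proof.
  Carried : State → State → (ℕ → Form → Form → Bool → Set) → ℕ → Form → Form → Bool → Set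
  Carried q q' L k C C' b = let C₀ = C ⟪ decode (proj₂ q) ⟫ ; C₀' = C' ⟪ decode (proj₂ q') ⟫ in
    C₀ ∈ ante (label q) × IsIndAtom C₀ × C₀' ∈ ante (label q') × IsIndAtom C₀' × L k C₀ C₀' b

  -- One inference of the new proof together with the old paths it stands for: `descend` runs
  -- through the silent steps and then one genuine inference, which makes it nonempty.
  record Expansion (q : State) : Set where
    field
      conclusion : Seq
      kids       : List State
      rule       : Rule Φ conclusion (map label kids)
      same       : label q ≈ₛ conclusion
      used       : Uses Φ Old (rname Φ rule)
      notSubst   : rname Φ rule ≢ Subst
      descend    : ∀ {k q'} → Nth kids k q' → Star (Edge Φ Old) (adr (proj₁ q)) (adr (proj₁ q'))
      nonempty   : ∀ {k q'} (n : Nth kids k q') → 1 ≤ steps (descend n)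
      carried    : ∀ {k q' C C' b} (n : Nth kids k q') → Along (descend n) C C' b
                 → Carried q q' (Link rule) k C C' b

  module Head {i j : Index} (chain : Star _⇝_ i j) (act : Active j) (c : Code) where
    open Active act public renaming (kids to subtrees)

    c₁ : Code
    c₁ = pushes chain c

    small : ∀ x → Occ x con → x < N
    small x o = occ<N j x (≈-occ {s = con} {sq j} (≈-sym {sq j} {con} eq) o)

    open Refresh Φ con small c₁ using (refresh; refresh-occ; admissible)

    at-head : At Φ D (adr j) (inf rl eq subtrees)
    at-head = ≡.subst (At Φ D (adr j)) tr≡ (at-node j)

    kid-index : KidIndices (adr j ∷ʳ_) subtrees
    kid-index m with index-of (at-∷ʳ at-head m)
    ... | l , e = l , cong proj₁ e , cong (λ x → proj₁ (proj₂ x)) e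

    indices : List Index
    indices = kidIndices (adr j ∷ʳ_) subtrees kid-index

    kids : List State
    kids = map (_, refresh) indices

    prems≡ : map (_⟪ decode refresh ⟫ₛ) prems ≡ map label kids
    prems≡ = trans (cong (map _) (sym (kidIndices-sq (adr j ∷ʳ_) subtrees kid-index)))
      (trans (sym (map-∘ indices)) (map-∘ indices))

    instance′ : Instance rl (decode refresh) (map label kids)
    instance′ = ≡.subst (Instance rl (decode refresh)) prems≡ (instantiate rl notSubst admissible)

    open Instance instance′ public

    con≡ : con ⟪ decode c₁ ⟫ₛ ≡ con ⟪ decode refresh ⟫ₛ
    con≡ = seq-cong con (λ x o → sym (refresh-occ x o))

    conclusion : Seq
    conclusion = con ⟪ decode refresh ⟫ₛ

    same : label (i , c) ≈ₛ conclusion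
    same = ≈-trans {label (i , c)} {label (j , c₁)} (pushes-label chain c)
      (≡.subst (label (j , c₁) ≈ₛ_) con≡ (≈-sub {sq j} {con} (decode c₁) eq))

    link : ∀ {k C C' b} → Link rl k C C' b → Link rule k (C ⟪ decode refresh ⟫) (C' ⟪ decode refresh ⟫) b
    link {k} {C} {C'} (corr l) = corr (corr⁺ {k} {C} {C'} l)
    link {k} {C} {C'} (unf l) = unf (unf⁺ {k} {C} {C'} l)

    module _ {k l c'} (n : Nth kids k (l , c')) where
      kid-addr : adr l ≡ adr j ∷ʳ k
      kid-addr with nth-map (_, refresh) n
      ... | _ , n' , refl = proj₂ (proj₂ (proj₂ (kidIndices-nth (adr j ∷ʳ_) subtrees kid-index n')))

      kid-code : c' ≡ refresh
      kid-code with nth-map (_, refresh) n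
      ... | _ , _ , refl = refl

      kid-edge : Edge Φ Old (adr j) (adr l)
      kid-edge with nth-map (_, refresh) n
      ... | _ , n' , refl with kidIndices-nth (adr j ∷ʳ_) subtrees kid-index n'
      ...   | _ , _ , m , e = ≡.subst (Edge Φ Old (adr j)) (sym e) (down at-head m)

      descend : Star (Edge Φ Old) (adr i) (adr l)
      descend = edges chain ◅◅ kid-edge ◅ ε

      carry : ∀ {C C₁ C' b} → C ⟪ decode c ⟫ ≡ C₁ ⟪ decode c₁ ⟫
            → C₁ ∈ ante (sq j) × IsIndAtom C₁ × Link rl k C₁ C' b
            → C' ∈ ante (sq l) × IsIndAtom C' → Carried (i , c) (l , c') (Link rule) k C C' b
      carry {C₁ = C₁} {C'} {b} e (m , ind , lk) (m' , ind') =
        ≡.subst (_∈ ante (label (i , c))) (sym e) (proj₂ (proj₁ (pushes-label chain c)) (∈-map⁺ _ m)) ,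
        ≡.subst IsIndAtom (sym e) (sub-ind ind) ,
        ∈-map⁺ _ m' , sub-ind ind' ,
        subst₂ (λ F c → Link rule k F (C' ⟪ decode c ⟫) b)
          -- All variables of `C₁` occur in the conclusion, so refreshing the code does not change
          -- its instance.
          (trans (subF-cong C₁ (λ x o → refresh-occ x (occ-ante {s = con} (proj₁ (proj₁ eq) m) o)) (λ _ → refl))
                 (sym e))
          (sym kid-code) (link lk)

      last-along : ∀ {C C₁ C' b} → C ⟪ decode c ⟫ ≡ C₁ ⟪ decode c₁ ⟫ → Along (kid-edge ◅ ε) C₁ C' b
                 → Carried (i , c) (l , c') (Link rule) k C C' b
      last-along {C} {C' = C'} e (_◅_ {b = b} t (ε live)) =
        ≡.subst (Carried (i , c) (l , c') (Link rule) k C C') (sym (∨-identityʳ b))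
          (carry e (step-inf Old t at-head kid-addr) (live-node {l} live))

      descend-along : ∀ {C C' b} → Along descend C C' b → Carried (i , c) (l , c') (Link rule) k C C' b
      descend-along al = let _ , e , al' = pushes-along chain c al in last-along e al'

      descend-nonempty : 1 ≤ steps descend
      descend-nonempty = ≤-trans (m≤n+m 1 _)
        (≤-reflexive (sym (steps-◅◅ (edges chain) (kid-edge ◅ ε))))

    expansion : Expansion (i , c)
    expansion = record
      { conclusion = conclusion
      ; kids = kids
      ; rule = rule
      ; same = same
      ; used = uses at-head (sym name)
      ; notSubst = λ e → notSubst (trans (sym name) e)
      ; descend = descend
      ; nonempty = descend-nonempty
      ; carried = λ n al → descend-along n al }

  abstract
    expand : ∀ q → Expansion q
    expand (i , c) = Head.expansion (proj₁ (proj₂ (settle i))) (proj₂ (proj₂ (settle i))) c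

-- Assembly and the global trace condition.

module SubstFreeProof {S : Sig} (Φ : List (Syn.Production S)) {s₀ : Syn.Seq S}
  (Pr : CProof Φ s₀) (atomic : AtomicSubsts Φ (pre Pr)) where
  open Syn S
  open Syntax S
  open Trees Φ
  open Nodes Φ
  open SilentSteps Φ Pr atomic
  open Codes N extra extra-atomic
  open Elimination Φ Pr atomic

  module H (q : State) = Expansion (expand q)

  states : List State
  states = L.cartesianProduct (allFin _) (allFin _)

  open Fold Φ label H.conclusion H.kids H.rule H.same states
    (λ q → ∈-cartesianProduct⁺ (∈-allFin (proj₁ q)) (∈-allFin (proj₂ q)))

  abstract
    origin : ∃[ q ] label q ≡ s₀
    origin with index-of here
    ... | i , e = (i , encode var identity-pool) , trans
      (seq-cong (sq i) (λ x o → decode-encode var identity-pool (occ<N i x o)))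
      (trans (cong₂ _⊢_ (id* (ante (sq i))) (id* (succe (sq i))))
        (cong (λ x → proj₁ (proj₂ x)) e))
      where
      identity-pool : ∀ v → v < N → var v ∈ pool
      identity-pool v p = pool-var (<-≤-trans p N≤)
      id* : ∀ Γ → Γ ⟪ var ⟫* ≡ Γ
      id* Γ = trans (map-cong subF-id Γ) (map-id Γ)

  open Folded (proj₁ origin) public
  open Position

  open Along {R = Edge Φ Old} (TStep Φ Old) Live

  -- A bud and its companion have the same state, so the projected path rests during a `jump`.
  segment : ∀ {anc a q anc' a' q'} {t : Unfolding anc a q} {t' : Unfolding anc' a' q'}
          → Move t t' → Star (Edge Φ Old) (adr (proj₁ q)) (adr (proj₁ q'))
  segment {q = q} (down m) = H.descend q (in-nth m)
  segment jump = ε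

  -- A `jump` ends at a `node`, from which only a `down` move is possible.
  segments-nonempty : ∀ {anc a q anc' a' q' anc'' a'' q''} {t : Unfolding anc a q}
                        {t' : Unfolding anc' a' q'} {t'' : Unfolding anc'' a'' q''}
                    → (m : Move t t') (m' : Move t' t'')
                    → 1 ≤ steps (segment m) + steps (segment m')
  segments-nonempty {q = q} (down m) _ = m≤n⇒m≤n+o _ (H.nonempty q (in-nth m))
  segments-nonempty {q' = q} jump (down m) = H.nonempty q (in-nth m)

  follow-trace : ∀ {anc a q anc' a' q'} {t : Unfolding anc a q} {t' : Unfolding anc' a' q'} {C C' b}
               → Sub t → (m : Move t t') → Along (segment m) C C' b
               → TStep Φ folded a a' (C ⟪ decode (proj₂ q) ⟫) (C' ⟪ decode (proj₂ q') ⟫) b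
  follow-trace {q = q} h (down m) al =
    let p , i , p' , i' , l = H.carried q (in-nth m) al in
    down-step h m p i p' i' l
  follow-trace {q = q} h jump (ε live) =
    let m , ind = live-node {proj₁ q} live in jump-step h (∈-map⁺ _ m) (sub-ind ind)

  module _ {π : ℕ → Addr} (pos : ∀ i → Position (π i))
           (move : ∀ i → Move (part (pos i)) (part (pos (suc i)))) where
    old-addr : ℕ → Addr
    old-addr i = adr (proj₁ (state (pos i)))

    old-segment : ∀ i → Star (Edge Φ Old) (old-addr i) (old-addr (suc i))
    old-segment i = segment (move i)

    open Flattening step-live old-addr old-segment
      (λ i → segments-nonempty (move i) (move (suc i))) renaming (π to old-path; π-edge to old-edge)

    lift-trace : (∃[ i₀ ] Σ (ℕ → Form) λ τ → Σ (ℕ → Bool) λ β →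
                    (∀ i → Along (old-segment (i + i₀)) (τ i) (τ (suc i)) (β i))
                    × (∀ j → ∃[ i ] (j ≤ i × β i ≡ true)))
               → ∃ (InfProgTrace Φ folded π)
    lift-trace (i₀ , τ , β , al , often) =
      i₀ , (λ i → τ i ⟪ decode (proj₂ (state (pos (i + i₀)))) ⟫) , β ,
      (λ i → follow-trace (sub (pos (i + i₀))) (move (i + i₀)) (al i)) , often

    trace-exists : ∃ (InfProgTrace Φ folded π)
    trace-exists with gtc Pr old-path old-edge
    ... | n , τ , β , t , often = lift-trace (transfer n τ β t often)

  global : GlobalTraceCondition Φ folded
  global π path = trace-exists (proj₁ (trajectory path)) (proj₂ (trajectory path))

  uses-old : ∀ {n} → Uses Φ folded n → Uses Φ Old n
  uses-old u = let q , e = uses-rule u in ≡.subst (Uses Φ Old) e (H.used q)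

  subst-free : SubstFree Φ folded
  subst-free u = let q , e = uses-rule u in H.notSubst q e

theorem4 : (S : Sig) (Φ : List (Syn.Production S)) (s : Syn.Seq S)
    (Pr : CutFreeProof Φ s)
    → AtomicSubsts Φ (pre (prf Pr))
    → Σ (CutFreeProof Φ s) λ Pr' →
    SubstFree Φ (pre (prf Pr'))
    × (∀ n → Uses Φ (pre (prf Pr')) n → Uses Φ (pre (prf Pr)) n)
-- The root carries the code of the identity, so its label equals `s` only by a proved equation,
-- along which the result is transported.
theorem4 S Φ s Pr atomic = ≡.subst
  (λ s' → Σ (CutFreeProof Φ s') λ Pr' →
    SubstFree Φ (pre (prf Pr')) × (∀ n → Uses Φ (pre (prf Pr')) n → Uses Φ (pre (prf Pr)) n))
  (proj₂ origin)
  (record { prf = record { pre = folded ; gtc = global } ; cutFree = λ u → cutFree Pr (uses-old u) }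
  , subst-free , λ n → uses-old)
  where
  open SubstFreeProof Φ (prf Pr) atomic
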